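{- Let $\mathcal{H}=(V,E)$ be a natural hb-graph with no repeated hb-edge and no empty hb-edge, with $V=\{v_1,\dots,v_n\}$ and at least one hb-edge, and let $\mathcal{A}_{\mathcal{H}}$ be any one of its three $e$-adjacency tensors (straightforward, silo or layered), of order $r_{\mathcal{H}}$ and dimension $n+n_{\mathcal{A}}$. Then every eigenvalue $\lambda$ of $\mathcal{A}_{\mathcal{H}}$ satisfies $$|\lambda|\leq\max(\Delta,\Delta^{\star})+r_{\mathcal{H}},$$ where $\Delta=\max_{1\le i\le n}d_i$ and $\Delta^{\star}=\max_{1\le i\le n_{\mathcal{A}}}d_{n+i}$ (with $\Delta^\star=0$ if $n_{\mathcal{A}}=0$).
   Context: A natural multiset with universe $V$ is given by a multiplicity function $V\to\mathbb{N}$; its support is the set of elements of nonzero multiplicity and its m-cardinality $\#_m$ is the sum of its multiplicities. A natural hb-graph $\mathcal{H}=(V,E)$ consists of a nonempty finite set $V$ and a finite family $E=(e_i)_{i\in\{1,\dots,p\}}$ of natural multisets with universe $V$ (hb-edges); no repeated hb-edge means the $e_i$ are pairwise distinct. Write $m_{i\,j}$ for the multiplicity of $v_j$ in $e_i$, and $r_{\mathcal{H}}=\max_{e\in E}\#_m e$. All three tensors are symmetric hypermatrices of order $r_{\mathcal{H}}$ and dimension $n+n_{\mathcal{A}}$ of the form $\sum_{i=1}^{p}T_i$, where $T_i$ is the contribution of $e_i=\{v_{j_1}^{m_{ij_1}},\ldots,v_{j_{k_i}}^{m_{ij_{k_i}}}\}$ (support $\{v_{j_1},\dots,v_{j_{k_i}}\}$).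 The nonzero entries of $T_i$ are exactly those whose index tuple is a permutation of a multiset $M_i$ of $r_{\mathcal{H}}$ indices, all having the same value $t_i$: - Straightforward: $n_{\mathcal{A}}=1$, $M_i=\{j_1^{m_{ij_1}},\ldots,j_{k_i}^{m_{ij_{k_i}}},(n+1)^{r_{\mathcal{H}}-\#_m e_i}\}$, $t_i=\dfrac{m_{ij_1}!\cdots m_{ij_{k_i}}!\,(r_{\mathcal{H}}-\#_m e_i)!}{(r_{\mathcal{H}}-1)!}$. - Silo: $n_{\mathcal{A}}=r_{\mathcal{H}}-1$, $M_i=\{j_1^{m_{ij_1}},\ldots,j_{k_i}^{m_{ij_{k_i}}},(n+\#_m e_i)^{r_{\mathcal{H}}-\#_m e_i}\}$ (no added index if $\#_m e_i=r_{\mathcal{H}}$), $t_i=\dfrac{m_{ij_1}!\cdots m_{ij_{k_i}}!\,(r_{\mathcal{H}}-\#_m e_i)!}{(r_{\mathcal{H}}-1)!}$. - Layered: $n_{\mathcal{A}}=r_{\mathcal{H}}-1$, $M_i=\{j_1^{m_{ij_1}},\ldots,j_{k_i}^{m_{ij_{k_i}}},(n+\#_m e_i)^{1},(n+\#_m e_i+1)^1,\ldots,(n+r_{\mathcal{H}}-1)^{1}\}$ (no added index if $\#_m e_i=r_{\mathcal{H}}$), $t_i=\dfrac{m_{ij_1}!\cdots m_{ij_{k_i}}!}{(r_{\mathcal{H}}-1)!}$. For $i\in\{1,\dots,n\}$, $d_i=\deg_m(v_i)=\sum_{l=1}^{p}m_{l\,i}$ is the m-degree of $v_i$. For $i\in\{1,\dots,n_{\mathcal{A}}\}$,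 $d_{n+i}=\deg_m(N_i)=\sum_{l=1}^p(\text{multiplicity of the index } n+i \text{ in } M_l)$ is the m-degree of the $i$-th added (null) vertex $N_i$ in the uniformized hb-graph. Eigenvalue: for a tensor $\mathcal{A}=(a_{i_1\ldots i_m})$ of order $m$ and dimension $N$, $\lambda\in\mathbb{C}$ is an eigenvalue if there is a nonzero $x\in\mathbb{C}^N$ with $(\mathcal{A}x^{m-1})_i=\lambda x_i^{m-1}$ for all $i\in\{1,\dots,N\}$, where $(\mathcal{A}x^{m-1})_i=\sum_{i_2,\dots,i_m=1}^{N}a_{i i_2\ldots i_m}x_{i_2}\cdots x_{i_m}$. -}

module Defs where

open import Algebra.Bundles using (RawSemiring)
import Algebra.Definitions.RawSemiring as RawSemiringOps
open import Data.Bool.Base using (if_then_else_)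
open import Data.Empty using (⊥-elim)
open import Data.Fin.Base using (Fin; zero; suc; toℕ; _↑ʳ_)
import Data.Fin.Properties as Fin
open import Data.Integer.Base as ℤ using (+_)
import Data.Integer.Properties as ℤ
open import Data.Nat.Base as ℕ using (ℕ; zero; suc; _∸_; _!)
import Data.Nat.Properties as ℕ
open import Data.Product.Base using (Σ; ∃; ∃₂; _×_; _,_)
open import Data.Rational.Base as ℚ using (ℚ; 0ℚ; 1ℚ; ½; toℚᵘ)
import Data.Rational.Properties as ℚ
import Data.Rational.Unnormalised.Base as ℚᵘ
import Data.Rational.Unnormalised.Properties as ℚᵘ
open import Data.Rational.Solver using (module +-*-Solver)
open import Data.Sum.Base using (inj₁; inj₂)
open import Data.Vec.Base as Vec using (Vec; []; _∷_)
open import Data.Vec.Functional using (Vector; foldr; _++_)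
open import Level using (0ℓ)
open import Relation.Binary.PropositionalEquality
open import Relation.Nullary using (¬_; Dec; yes; no)
open import Relation.Nullary.Decidable using (⌊_⌋)

open +-*-Solver using (solve; con; _:+_; _:*_; _:-_; :-_; _:=_)
open RawSemiringOps ℚ.+-*-rawSemiring using () renaming (_×_ to _·_; _^_ to _^ℚ_; sum to sumℚ)
open RawSemiringOps ℕ.+-*-rawSemiring using () renaming (sum to sumℕ; product to productℕ)

module RationalFacts where

  half-pos : ∀ {ε} → 0ℚ ℚ.< ε → 0ℚ ℚ.< ½ ℚ.* ε
  half-pos {ε} 0<ε =
    ℚ.positive⁻¹ (½ ℚ.* ε) {{ℚ.pos*pos⇒pos ½ ε {{ℚ.positive 0<ε}}}}

  halves : ∀ ε → ½ ℚ.* ε ℚ.+ ½ ℚ.* ε ≡ ε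
  halves = solve 1 (λ e → con ½ :* e :+ con ½ :* e := e) refl

  0≤* : ∀ {p q} → 0ℚ ℚ.≤ p → 0ℚ ℚ.≤ q → 0ℚ ℚ.≤ p ℚ.* q
  0≤* {p} {q} 0≤p 0≤q = ℚ.nonNegative⁻¹ (p ℚ.* q)
    {{ℚ.nonNeg*nonNeg⇒nonNeg p {{ℚ.nonNegative 0≤p}} q {{ℚ.nonNegative 0≤q}}}}

  0≤+ : ∀ {p q} → 0ℚ ℚ.≤ p → 0ℚ ℚ.≤ q → 0ℚ ℚ.≤ p ℚ.+ q
  0≤+ = ℚ.+-mono-≤

  *-mono-≤ : ∀ {p q r s} → 0ℚ ℚ.≤ p → 0ℚ ℚ.≤ s → p ℚ.≤ q → r ℚ.≤ s → p ℚ.* r ℚ.≤ q ℚ.* s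
  *-mono-≤ {p} {q} {r} {s} 0≤p 0≤s p≤q r≤s = ℚ.≤-trans
    (ℚ.*-monoˡ-≤-nonNeg p {{ℚ.nonNegative 0≤p}} r≤s)
    (ℚ.*-monoʳ-≤-nonNeg s {{ℚ.nonNegative 0≤s}} p≤q)

  p≤∣p∣ : ∀ p → p ℚ.≤ ℚ.∣ p ∣
  p≤∣p∣ p with ℚ.≤-total 0ℚ p
  ... | inj₁ 0≤p = ℚ.≤-reflexive (sym (ℚ.0≤p⇒∣p∣≡p 0≤p))
  ... | inj₂ p≤0 = ℚ.≤-trans p≤0 (ℚ.0≤∣p∣ p)

  ∣p-q∣≡∣q-p∣ : ∀ p q → ℚ.∣ p ℚ.- q ∣ ≡ ℚ.∣ q ℚ.- p ∣
  ∣p-q∣≡∣q-p∣ p q = trans (sym (ℚ.∣-p∣≡∣p∣ (p ℚ.- q)))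
    (cong ℚ.∣_∣ (solve 2 (λ a b → :- (a :- b) := b :- a) refl p q))

  ∣p-q∣≤⇒p≤q+ : ∀ p q {ε} → ℚ.∣ p ℚ.- q ∣ ℚ.≤ ε → p ℚ.≤ q ℚ.+ ε
  ∣p-q∣≤⇒p≤q+ p q h = subst (ℚ._≤ _) (solve 2 (λ a b → b :+ (a :- b) := a) refl p q)
    (ℚ.+-monoʳ-≤ q (ℚ.≤-trans (p≤∣p∣ (p ℚ.- q)) h))

  p≤q+⇒p-q≤ : ∀ p q {ε} → p ℚ.≤ q ℚ.+ ε → p ℚ.- q ℚ.≤ ε
  p≤q+⇒p-q≤ p q {ε} h = subst (p ℚ.- q ℚ.≤_)
    (solve 2 (λ b e → (b :+ e) :- b := e) refl q ε) (ℚ.+-monoˡ-≤ (ℚ.- q) h)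

  ∣p-q∣≤ : ∀ p q {ε} → p ℚ.≤ q ℚ.+ ε → q ℚ.≤ p ℚ.+ ε → ℚ.∣ p ℚ.- q ∣ ℚ.≤ ε
  ∣p-q∣≤ p q h k with ℚ.∣p∣≡p∨∣p∣≡-p (p ℚ.- q)
  ... | inj₁ e = subst (ℚ._≤ _) (sym e) (p≤q+⇒p-q≤ p q h)
  ... | inj₂ e = subst (ℚ._≤ _)
    (sym (trans e (solve 2 (λ a b → :- (a :- b) := b :- a) refl p q))) (p≤q+⇒p-q≤ q p k)

  ·-toℚᵘ : ∀ n ε → toℚᵘ (n · ε) ℚᵘ.≃ (+ n ℚᵘ./ 1) ℚᵘ.* toℚᵘ ε
  ·-toℚᵘ zero    ε = ℚᵘ.≃-sym (ℚᵘ.*-zeroˡ (toℚᵘ ε))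
  ·-toℚᵘ (suc n) ε = begin-equality
    toℚᵘ (ε ℚ.+ n · ε)                           ≃⟨ ℚ.toℚᵘ-homo-+ ε (n · ε) ⟩
    e ℚᵘ.+ toℚᵘ (n · ε)                          ≃⟨ ℚᵘ.+-congʳ e (·-toℚᵘ n ε) ⟩
    e ℚᵘ.+ (+ n ℚᵘ./ 1) ℚᵘ.* e                   ≃⟨ ℚᵘ.+-congˡ ((+ n ℚᵘ./ 1) ℚᵘ.* e) (ℚᵘ.*-identityˡ e) ⟨
    ℚᵘ.1ℚᵘ ℚᵘ.* e ℚᵘ.+ (+ n ℚᵘ./ 1) ℚᵘ.* e       ≃⟨ ℚᵘ.*-distribʳ-+ e ℚᵘ.1ℚᵘ (+ n ℚᵘ./ 1) ⟨
    (ℚᵘ.1ℚᵘ ℚᵘ.+ (+ n ℚᵘ./ 1)) ℚᵘ.* e            ≃⟨ ℚᵘ.*-congʳ {e} {ℚᵘ.1ℚᵘ ℚᵘ.+ (+ n ℚᵘ./ 1)} {+ suc n ℚᵘ./ 1}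
                                                      (ℚᵘ.*≡* (cong (λ i → (+ 1 ℤ.+ i) ℤ.* + 1) (ℤ.*-identityʳ (+ n)))) ⟩
    (+ suc n ℚᵘ./ 1) ℚᵘ.* e                      ∎
    where open ℚᵘ.≤-Reasoning
          e = toℚᵘ ε

  archimedean : ∀ K {ε} → 0ℚ ℚ.< ε → ∃ λ n → K ℚ.≤ n · ε
  archimedean K@(ℚ.mkℚ k d _) {ε@(ℚ.mkℚ (+ suc a) b _)} 0<ε = n , ℚ.toℚᵘ-cancel-≤
    (ℚᵘ.≤-respʳ-≃ (ℚᵘ.≃-sym (·-toℚᵘ n ε)) (ℚᵘ.*≤* (begin
      k ℤ.* + suc (b ℕ.+ 0)              ≡⟨ cong (λ i → k ℤ.* + suc i) (ℕ.+-identityʳ b) ⟩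
      k ℤ.* + suc b                      ≤⟨ ℤ.*-monoʳ-≤-nonNeg (+ suc b) (i≤∣i∣ k) ⟩
      + ℤ.∣ k ∣ ℤ.* + suc b              ≡⟨ ℤ.pos-* ℤ.∣ k ∣ (suc b) ⟨
      + n                                ≤⟨ ℤ.+≤+ (ℕ.≤-trans (ℕ.m≤m*n n (suc a)) (ℕ.m≤m*n (n ℕ.* suc a) (suc d))) ⟩
      + (n ℕ.* suc a ℕ.* suc d)          ≡⟨ ℤ.pos-* (n ℕ.* suc a) (suc d) ⟩
      + (n ℕ.* suc a) ℤ.* + suc d        ≡⟨ cong (ℤ._* + suc d) (ℤ.pos-* n (suc a)) ⟩
      + n ℤ.* + suc a ℤ.* + suc d        ∎)))
    where
    open ℤ.≤-Reasoning
    n = ℤ.∣ k ∣ ℕ.* suc b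
    i≤∣i∣ : ∀ i → i ℤ.≤ + ℤ.∣ i ∣
    i≤∣i∣ (+ _)      = ℤ.≤-refl
    i≤∣i∣ ℤ.-[1+ _ ] = ℤ.-≤+
  archimedean K {ℚ.mkℚ (+ zero) _ _}    (ℚ.*<* (ℤ.+<+ ()))
  archimedean K {ℚ.mkℚ ℤ.-[1+ _ ] _ _} (ℚ.*<* ())

  0≤½^ : ∀ n → 0ℚ ℚ.≤ ½ ^ℚ n
  0≤½^ zero    = ℚ.nonNegative⁻¹ 1ℚ
  0≤½^ (suc n) = 0≤* (ℚ.nonNegative⁻¹ ½) (0≤½^ n)

  ½^≤1 : ∀ n → ½ ^ℚ n ℚ.≤ 1ℚ
  ½^≤1 zero    = ℚ.≤-refl
  ½^≤1 (suc n) = ℚ.≤-trans (ℚ.*-monoˡ-≤-nonNeg ½ (½^≤1 n)) (ℚ.≤ᵇ⇒≤ _)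

  ·-½^ : ∀ {ε} → 0ℚ ℚ.≤ ε → ∀ {m n} → m ℕ.≤ n → (m · ε) ℚ.* ½ ^ℚ n ℚ.≤ ε
  ·-½^ {ε} 0≤ε {n = n} ℕ.z≤n = subst (ℚ._≤ ε) (sym (ℚ.*-zeroˡ (½ ^ℚ n))) 0≤ε
  ·-½^ {ε} 0≤ε {suc m} {suc n} (ℕ.s≤s m≤n) = begin
    (ε ℚ.+ m · ε) ℚ.* (½ ℚ.* h)                       ≡⟨ solve 3 (λ e f g → (e :+ f) :* (con ½ :* g) :=
                                                              con ½ :* (e :* g) :+ con ½ :* (f :* g)) refl ε (m · ε) h ⟩
    ½ ℚ.* (ε ℚ.* h) ℚ.+ ½ ℚ.* ((m · ε) ℚ.* h)         ≤⟨ ℚ.+-mono-≤ (ℚ.*-monoˡ-≤-nonNeg ½ εh≤ε) (ℚ.*-monoˡ-≤-nonNeg ½ (·-½^ 0≤ε m≤n)) ⟩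
    ½ ℚ.* ε ℚ.+ ½ ℚ.* ε                               ≡⟨ halves ε ⟩
    ε                                                 ∎
    where
    open ℚ.≤-Reasoning
    h = ½ ^ℚ n
    εh≤ε : ε ℚ.* h ℚ.≤ ε
    εh≤ε = subst (ε ℚ.* h ℚ.≤_) (ℚ.*-identityʳ ε)
      (ℚ.*-monoˡ-≤-nonNeg ε {{ℚ.nonNegative 0≤ε}} (½^≤1 n))

  geometric : ∀ K {ε} → 0ℚ ℚ.< ε → ∃ λ N → ∀ n → N ℕ.≤ n → K ℚ.* ½ ^ℚ n ℚ.≤ ε
  geometric K {ε} 0<ε with archimedean K 0<ε
  ... | N , K≤Nε = N , λ n N≤n → ℚ.≤-trans
    (ℚ.*-monoʳ-≤-nonNeg (½ ^ℚ n) {{ℚ.nonNegative (0≤½^ n)}} K≤Nε) (·-½^ (ℚ.<⇒≤ 0<ε) N≤n)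

open RationalFacts

-- The modulus of convergence is unconstrained, so the ring operations below act
-- termwise on the sequences.
Cauchy : (ℕ → ℚ) → Set
Cauchy s = ∀ {ε} → 0ℚ ℚ.< ε → ∃ λ N → ∀ m n → N ℕ.≤ m → N ℕ.≤ n → ℚ.∣ s m ℚ.- s n ∣ ℚ.≤ ε

record ℝ : Set where
  constructor mkℝ
  field
    seq    : ℕ → ℚ
    cauchy : Cauchy seq

open ℝ public

infix 4 _≃ℝ_ _≤ℝ_

_≃ℝ_ : ℝ → ℝ → Set
x ≃ℝ y = ∀ {ε} → 0ℚ ℚ.< ε → ∃ λ N → ∀ n → N ℕ.≤ n → ℚ.∣ seq x n ℚ.- seq y n ∣ ℚ.≤ ε

_≤ℝ_ : ℝ → ℝ → Set
x ≤ℝ y = ∀ {ε} → 0ℚ ℚ.< ε → ∃ λ N → ∀ n → N ℕ.≤ n → seq x n ℚ.≤ seq y n ℚ.+ ε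

fromℚ : ℚ → ℝ
fromℚ q = mkℝ (λ _ → q) λ 0<ε → 0 , λ _ _ _ _ →
  subst (ℚ._≤ _) (sym (cong ℚ.∣_∣ (ℚ.+-inverseʳ q))) (ℚ.<⇒≤ 0<ε)

fromℕ : ℕ → ℝ
fromℕ n = fromℚ (+ n ℚ./ 1)

infixl 6 _+ℝ_
infixl 7 _*ℝ_

_+ℝ_ : ℝ → ℝ → ℝ
x +ℝ y = mkℝ (λ n → seq x n ℚ.+ seq y n) λ {ε} 0<ε →
  let (M , hx) = cauchy x (half-pos 0<ε)
      (N , hy) = cauchy y (half-pos 0<ε)
  in M ℕ.⊔ N , λ m n M⊔N≤m M⊔N≤n → let open ℚ.≤-Reasoning in begin
    ℚ.∣ (seq x m ℚ.+ seq y m) ℚ.- (seq x n ℚ.+ seq y n) ∣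
      ≡⟨ cong ℚ.∣_∣ (solve 4 (λ a b c d → (a :+ b) :- (c :+ d) := (a :- c) :+ (b :- d)) refl
           (seq x m) (seq y m) (seq x n) (seq y n)) ⟩
    ℚ.∣ (seq x m ℚ.- seq x n) ℚ.+ (seq y m ℚ.- seq y n) ∣
      ≤⟨ ℚ.∣p+q∣≤∣p∣+∣q∣ (seq x m ℚ.- seq x n) (seq y m ℚ.- seq y n) ⟩
    ℚ.∣ seq x m ℚ.- seq x n ∣ ℚ.+ ℚ.∣ seq y m ℚ.- seq y n ∣
      ≤⟨ ℚ.+-mono-≤ (hx m n (ℕ.m⊔n≤o⇒m≤o M N M⊔N≤m) (ℕ.m⊔n≤o⇒m≤o M N M⊔N≤n))
                    (hy m n (ℕ.m⊔n≤o⇒n≤o M N M⊔N≤m) (ℕ.m⊔n≤o⇒n≤o M N M⊔N≤n)) ⟩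
    ½ ℚ.* ε ℚ.+ ½ ℚ.* ε
      ≡⟨ halves ε ⟩
    ε ∎

-ℝ_ : ℝ → ℝ
-ℝ x = mkℝ (λ n → ℚ.- seq x n) λ 0<ε →
  let (N , h) = cauchy x 0<ε
  in N , λ m n N≤m N≤n → subst (ℚ._≤ _)
    (trans (∣p-q∣≡∣q-p∣ (seq x m) (seq x n))
      (cong ℚ.∣_∣ (solve 2 (λ a b → b :- a := (:- a) :- (:- b)) refl (seq x m) (seq x n))))
    (h m n N≤m N≤n)

module Bounds where

  bounded : ∀ x → ∃₂ λ N K → 0ℚ ℚ.< K × (∀ n → N ℕ.≤ n → ℚ.∣ seq x n ∣ ℚ.≤ K)
  bounded x with cauchy x (ℚ.positive⁻¹ 1ℚ)
  ... | N , h = N , ℚ.∣ a ∣ ℚ.+ 1ℚ , ℚ.+-mono-≤-< (ℚ.0≤∣p∣ a) (ℚ.positive⁻¹ 1ℚ) , λ n N≤n →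
    let open ℚ.≤-Reasoning in begin
    ℚ.∣ seq x n ∣                          ≡⟨ cong ℚ.∣_∣ (solve 2 (λ u v → u := v :+ (u :- v)) refl (seq x n) a) ⟩
    ℚ.∣ a ℚ.+ (seq x n ℚ.- a) ∣            ≤⟨ ℚ.∣p+q∣≤∣p∣+∣q∣ a (seq x n ℚ.- a) ⟩
    ℚ.∣ a ∣ ℚ.+ ℚ.∣ seq x n ℚ.- a ∣        ≤⟨ ℚ.+-monoʳ-≤ ℚ.∣ a ∣ (h n N N≤n ℕ.≤-refl) ⟩
    ℚ.∣ a ∣ ℚ.+ 1ℚ                         ∎
    where a = seq x N

  -- An ε/2-tolerance for one factor when the other is bounded by K.
  scaled : ∀ {K ε} → 0ℚ ℚ.< K → 0ℚ ℚ.< ε → ∃ λ δ → 0ℚ ℚ.< δ × K ℚ.* δ ≡ ½ ℚ.* ε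
  scaled {K} {ε} 0<K 0<ε = ½ ℚ.* ε ℚ.* ℚ.1/ K ,
    ℚ.positive⁻¹ _ {{ℚ.pos*pos⇒pos (½ ℚ.* ε) {{ℚ.positive (half-pos 0<ε)}} (ℚ.1/ K) {{ℚ.1/pos⇒pos K}}}} ,
    (begin
      K ℚ.* (½ ℚ.* ε ℚ.* ℚ.1/ K)       ≡⟨ solve 3 (λ k e i → k :* (e :* i) := e :* (k :* i)) refl K (½ ℚ.* ε) (ℚ.1/ K) ⟩
      ½ ℚ.* ε ℚ.* (K ℚ.* ℚ.1/ K)       ≡⟨ cong (½ ℚ.* ε ℚ.*_) (ℚ.*-inverseʳ K) ⟩
      ½ ℚ.* ε ℚ.* 1ℚ                   ≡⟨ ℚ.*-identityʳ (½ ℚ.* ε) ⟩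
      ½ ℚ.* ε                          ∎)
    where
    open ≡-Reasoning
    instance
      K-pos : ℚ.Positive K
      K-pos = ℚ.positive 0<K
      K-nonZero : ℚ.NonZero K
      K-nonZero = ℚ.pos⇒nonZero K

open Bounds

_*ℝ_ : ℝ → ℝ → ℝ
x *ℝ y = mkℝ (λ n → seq x n ℚ.* seq y n) λ {ε} 0<ε →
  let (N₁ , K , 0<K , bx) = bounded x
      (N₂ , L , 0<L , by) = bounded y
      (δ , 0<δ , Kδ)      = scaled 0<K 0<ε
      (η , 0<η , Lη)      = scaled 0<L 0<ε
      (N₃ , hy)           = cauchy y 0<δ
      (N₄ , hx)           = cauchy x 0<η
      N₁₂ = N₁ ℕ.⊔ N₂
      N₃₄ = N₃ ℕ.⊔ N₄
  in N₁₂ ℕ.⊔ N₃₄ , λ m n N≤m N≤n →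
    let open ℚ.≤-Reasoning
        l₁ : ∀ {k} → N₁₂ ℕ.⊔ N₃₄ ℕ.≤ k → N₁ ℕ.≤ k
        l₁ le = ℕ.m⊔n≤o⇒m≤o N₁ N₂ (ℕ.m⊔n≤o⇒m≤o N₁₂ N₃₄ le)
        l₂ : ∀ {k} → N₁₂ ℕ.⊔ N₃₄ ℕ.≤ k → N₂ ℕ.≤ k
        l₂ le = ℕ.m⊔n≤o⇒n≤o N₁ N₂ (ℕ.m⊔n≤o⇒m≤o N₁₂ N₃₄ le)
        l₃ : ∀ {k} → N₁₂ ℕ.⊔ N₃₄ ℕ.≤ k → N₃ ℕ.≤ k
        l₃ le = ℕ.m⊔n≤o⇒m≤o N₃ N₄ (ℕ.m⊔n≤o⇒n≤o N₁₂ N₃₄ le)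
        l₄ : ∀ {k} → N₁₂ ℕ.⊔ N₃₄ ℕ.≤ k → N₄ ℕ.≤ k
        l₄ le = ℕ.m⊔n≤o⇒n≤o N₃ N₄ (ℕ.m⊔n≤o⇒n≤o N₁₂ N₃₄ le)
        u = seq x m ; v = seq y m ; u′ = seq x n ; v′ = seq y n
    in begin
    ℚ.∣ u ℚ.* v ℚ.- u′ ℚ.* v′ ∣
      ≡⟨ cong ℚ.∣_∣ (solve 4 (λ a b c d → a :* b :- c :* d := a :* (b :- d) :+ d :* (a :- c)) refl u v u′ v′) ⟩
    ℚ.∣ u ℚ.* (v ℚ.- v′) ℚ.+ v′ ℚ.* (u ℚ.- u′) ∣
      ≤⟨ ℚ.∣p+q∣≤∣p∣+∣q∣ (u ℚ.* (v ℚ.- v′)) (v′ ℚ.* (u ℚ.- u′)) ⟩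
    ℚ.∣ u ℚ.* (v ℚ.- v′) ∣ ℚ.+ ℚ.∣ v′ ℚ.* (u ℚ.- u′) ∣
      ≡⟨ cong₂ ℚ._+_ (ℚ.∣p*q∣≡∣p∣*∣q∣ u (v ℚ.- v′)) (ℚ.∣p*q∣≡∣p∣*∣q∣ v′ (u ℚ.- u′)) ⟩
    ℚ.∣ u ∣ ℚ.* ℚ.∣ v ℚ.- v′ ∣ ℚ.+ ℚ.∣ v′ ∣ ℚ.* ℚ.∣ u ℚ.- u′ ∣
      ≤⟨ ℚ.+-mono-≤
           (*-mono-≤ (ℚ.0≤∣p∣ u) (ℚ.<⇒≤ 0<δ) (bx m (l₁ N≤m)) (hy m n (l₃ N≤m) (l₃ N≤n)))
           (*-mono-≤ (ℚ.0≤∣p∣ v′) (ℚ.<⇒≤ 0<η) (by n (l₂ N≤n)) (hx m n (l₄ N≤m) (l₄ N≤n))) ⟩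
    K ℚ.* δ ℚ.+ L ℚ.* η
      ≡⟨ cong₂ ℚ._+_ Kδ Lη ⟩
    ½ ℚ.* ε ℚ.+ ½ ℚ.* ε
      ≡⟨ halves ε ⟩
    ε ∎

-- Bisection for √q, q ≥ 0: the invariant is a² ≤ q < (a + (1 + q) / 2ⁿ)²,
-- where a is the n-th iterate.
bisect√ : ℚ → ℕ → ℚ
bisect√ q zero    = 0ℚ
bisect√ q (suc n) with bisect√ q n ℚ.+ (1ℚ ℚ.+ q) ℚ.* ½ ^ℚ suc n
... | b with b ℚ.* b ℚ.≤? q
...   | yes _ = b
...   | no  _ = bisect√ q n

module Bisection where

  width : ℚ → ℕ → ℚ
  width q n = (1ℚ ℚ.+ q) ℚ.* ½ ^ℚ n

  0≤width : ∀ {q} n → 0ℚ ℚ.≤ q → 0ℚ ℚ.≤ width q n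
  0≤width n 0≤q = 0≤* (0≤+ (ℚ.nonNegative⁻¹ 1ℚ) 0≤q) (0≤½^ n)

  record Brackets (q a w : ℚ) : Set where
    field
      0≤a   : 0ℚ ℚ.≤ a
      lower : a ℚ.* a ℚ.≤ q
      upper : q ℚ.< (a ℚ.+ w) ℚ.* (a ℚ.+ w)

  open Brackets

  bisect√-brackets : ∀ {q} → 0ℚ ℚ.≤ q → ∀ n → Brackets q (bisect√ q n) (width q n)
  bisect√-brackets {q} 0≤q zero = record
    { 0≤a   = ℚ.≤-refl
    ; lower = 0≤q
    ; upper = begin-strict
        q                                        ≡⟨ ℚ.+-identityˡ q ⟨
        0ℚ ℚ.+ q                                 <⟨ ℚ.+-mono-<-≤ (ℚ.positive⁻¹ 1ℚ) q≤ ⟩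
        1ℚ ℚ.+ (q ℚ.+ (q ℚ.+ q ℚ.* q))           ≡⟨ solve 1 (λ p → con 1ℚ :+ (p :+ (p :+ p :* p)) :=
                                                     (con 0ℚ :+ (con 1ℚ :+ p) :* con 1ℚ) :* (con 0ℚ :+ (con 1ℚ :+ p) :* con 1ℚ)) refl q ⟩
        (0ℚ ℚ.+ width q 0) ℚ.* (0ℚ ℚ.+ width q 0) ∎
    }
    where
    open ℚ.≤-Reasoning
    q≤ : q ℚ.≤ q ℚ.+ (q ℚ.+ q ℚ.* q)
    q≤ = subst (ℚ._≤ q ℚ.+ (q ℚ.+ q ℚ.* q)) (ℚ.+-identityʳ q) (ℚ.+-monoʳ-≤ q (0≤+ 0≤q (0≤* 0≤q 0≤q)))
  bisect√-brackets {q} 0≤q (suc n)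
    with b² ℚ.≤? q | bisect√-brackets 0≤q n
    where b² = (bisect√ q n ℚ.+ width q (suc n)) ℚ.* (bisect√ q n ℚ.+ width q (suc n))
  ... | yes b²≤q | ih = record
    { 0≤a   = 0≤+ (0≤a ih) (0≤width (suc n) 0≤q)
    ; lower = b²≤q
    ; upper = subst (λ c → q ℚ.< c ℚ.* c)
        (solve 3 (λ a p h → a :+ p :* h := (a :+ p :* (con ½ :* h)) :+ p :* (con ½ :* h)) refl
          (bisect√ q n) (1ℚ ℚ.+ q) (½ ^ℚ n))
        (upper ih)
    }
  ... | no b²≰q | ih = record { 0≤a = 0≤a ih ; lower = lower ih ; upper = ℚ.≰⇒> b²≰q }

  bisect√-compare : ∀ {p q a b v w η} → 0ℚ ℚ.≤ w → 0ℚ ℚ.≤ η → p ℚ.≤ q ℚ.+ η ℚ.* η →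
                    Brackets p a v → Brackets q b w → a ℚ.≤ b ℚ.+ w ℚ.+ η
  bisect√-compare {p} {q} {a} {b} {v} {w} {η} 0≤w 0≤η p≤q+η² A B with a ℚ.≤? b ℚ.+ w ℚ.+ η
  ... | yes le = le
  ... | no ¬le = ⊥-elim (ℚ.<-irrefl refl (begin-strict
    a ℚ.* a                                            ≤⟨ lower A ⟩
    p                                                  ≤⟨ p≤q+η² ⟩
    q ℚ.+ η ℚ.* η                                      <⟨ ℚ.+-monoˡ-< (η ℚ.* η) (upper B) ⟩
    c ℚ.* c ℚ.+ η ℚ.* η                                ≡⟨ ℚ.+-identityʳ _ ⟨
    c ℚ.* c ℚ.+ η ℚ.* η ℚ.+ 0ℚ                         ≤⟨ ℚ.+-monoʳ-≤ (c ℚ.* c ℚ.+ η ℚ.* η) (0≤+ (0≤* 0≤c 0≤η) (0≤* 0≤c 0≤η)) ⟩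
    c ℚ.* c ℚ.+ η ℚ.* η ℚ.+ (c ℚ.* η ℚ.+ c ℚ.* η)      ≡⟨ solve 2 (λ x y → x :* x :+ y :* y :+ (x :* y :+ x :* y) := (x :+ y) :* (x :+ y)) refl c η ⟩
    (c ℚ.+ η) ℚ.* (c ℚ.+ η)                            ≤⟨ *-mono-≤ 0≤c+η (0≤a A) c+η≤a c+η≤a ⟩
    a ℚ.* a                                            ∎))
    where
    open ℚ.≤-Reasoning
    c = b ℚ.+ w
    0≤c = 0≤+ (0≤a B) 0≤w
    0≤c+η = 0≤+ 0≤c 0≤η
    c+η≤a = ℚ.<⇒≤ (ℚ.≰⇒> ¬le)

  ⁺-mono : ∀ {p q ε} → 0ℚ ℚ.≤ ε → p ℚ.≤ q ℚ.+ ε → 0ℚ ℚ.⊔ p ℚ.≤ (0ℚ ℚ.⊔ q) ℚ.+ ε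
  ⁺-mono {p} {q} 0≤ε p≤q+ε = ℚ.⊔-lub
    (0≤+ (ℚ.p≤p⊔q 0ℚ q) 0≤ε)
    (ℚ.≤-trans p≤q+ε (ℚ.+-monoˡ-≤ _ (ℚ.p≤q⊔p 0ℚ q)))

open Bisection

-- The square root of the nonnegative part.
√_ : ℝ → ℝ
√ x = mkℝ (λ n → bisect√ (0ℚ ℚ.⊔ seq x n) n) λ {ε} 0<ε →
  let η = ½ ℚ.* ε
      0<η = half-pos 0<ε
      (N₁ , K , 0<K , bx) = bounded x
      (N₂ , hw) = geometric (1ℚ ℚ.+ K) 0<η
      (N₃ , hx) = cauchy x (ℚ.positive⁻¹ (η ℚ.* η) {{ℚ.pos*pos⇒pos η {{ℚ.positive 0<η}} η {{ℚ.positive 0<η}}}})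
      N = N₁ ℕ.⊔ (N₂ ℕ.⊔ N₃)
      l₂₃ : ∀ {k} → N ℕ.≤ k → N₂ ℕ.⊔ N₃ ℕ.≤ k
      l₂₃ = ℕ.m⊔n≤o⇒n≤o N₁ (N₂ ℕ.⊔ N₃)
      q = λ n → 0ℚ ℚ.⊔ seq x n
      0≤q : ∀ n → 0ℚ ℚ.≤ q n
      0≤q n = ℚ.p≤p⊔q 0ℚ (seq x n)
      width≤η : ∀ n → N ℕ.≤ n → width (q n) n ℚ.≤ η
      width≤η n N≤n = ℚ.≤-trans
        (ℚ.*-monoʳ-≤-nonNeg (½ ^ℚ n) {{ℚ.nonNegative (0≤½^ n)}} (ℚ.+-monoʳ-≤ 1ℚ
          (ℚ.⊔-lub (ℚ.<⇒≤ 0<K) (ℚ.≤-trans (p≤∣p∣ (seq x n)) (bx n (ℕ.m⊔n≤o⇒m≤o N₁ _ N≤n))))))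
        (hw n (ℕ.m⊔n≤o⇒m≤o N₂ N₃ (l₂₃ N≤n)))
      one-sided : ∀ m n → N ℕ.≤ m → N ℕ.≤ n → bisect√ (q m) m ℚ.≤ bisect√ (q n) n ℚ.+ ε
      one-sided m n N≤m N≤n = let open ℚ.≤-Reasoning in begin
        bisect√ (q m) m
          ≤⟨ bisect√-compare (0≤width n (0≤q n)) (ℚ.<⇒≤ 0<η)
               (⁺-mono {seq x m} {seq x n} (0≤* (ℚ.<⇒≤ 0<η) (ℚ.<⇒≤ 0<η)) (∣p-q∣≤⇒p≤q+ (seq x m) (seq x n)
                 (hx m n (ℕ.m⊔n≤o⇒n≤o N₂ N₃ (l₂₃ N≤m)) (ℕ.m⊔n≤o⇒n≤o N₂ N₃ (l₂₃ N≤n)))))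
               (bisect√-brackets (0≤q m) m) (bisect√-brackets (0≤q n) n) ⟩
        bisect√ (q n) n ℚ.+ width (q n) n ℚ.+ η
          ≤⟨ ℚ.+-monoˡ-≤ η (ℚ.+-monoʳ-≤ (bisect√ (q n) n) (width≤η n N≤n)) ⟩
        bisect√ (q n) n ℚ.+ η ℚ.+ η
          ≡⟨ trans (ℚ.+-assoc (bisect√ (q n) n) η η) (cong (bisect√ (q n) n ℚ.+_) (halves ε)) ⟩
        bisect√ (q n) n ℚ.+ ε ∎
  in N , λ m n N≤m N≤n → ∣p-q∣≤ _ _ (one-sided m n N≤m N≤n) (one-sided n m N≤n N≤m)

record ℂ : Set where
  constructor _+i_
  field
    re : ℝ
    im : ℝ

open ℂ public

infix 4 _≃ℂ_
infixl 6 _+ℂ_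
infixl 7 _*ℂ_

_≃ℂ_ : ℂ → ℂ → Set
z ≃ℂ w = re z ≃ℝ re w × im z ≃ℝ im w

_+ℂ_ : ℂ → ℂ → ℂ
z +ℂ w = (re z +ℝ re w) +i (im z +ℝ im w)

_*ℂ_ : ℂ → ℂ → ℂ
z *ℂ w = (re z *ℝ re w +ℝ -ℝ (im z *ℝ im w)) +i (re z *ℝ im w +ℝ im z *ℝ re w)

ℚ→ℂ : ℚ → ℂ
ℚ→ℂ q = fromℚ q +i fromℚ 0ℚ

0ℂ 1ℂ : ℂ
0ℂ = ℚ→ℂ 0ℚ
1ℂ = ℚ→ℂ 1ℚ

∣_∣ℂ : ℂ → ℝ
∣ z ∣ℂ = √ (re z *ℝ re z +ℝ im z *ℝ im z)

ℂ-rawSemiring : RawSemiring 0ℓ 0ℓ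
ℂ-rawSemiring = record
  { Carrier = ℂ
  ; _≈_     = _≃ℂ_
  ; _+_     = _+ℂ_
  ; _*_     = _*ℂ_
  ; 0#      = 0ℂ
  ; 1#      = 1ℂ
  }

open RawSemiringOps ℂ-rawSemiring using () renaming (_^_ to _^ℂ_; sum to sumℂ)

Hypermatrix : Set → ℕ → ℕ → Set
Hypermatrix A m N = Vec (Fin N) m → A

∑tuples : ∀ {N} k → (Vec (Fin N) k → ℂ) → ℂ
∑tuples zero    f = f []
∑tuples (suc k) f = sumℂ λ j → ∑tuples k λ α → f (j ∷ α)

monomial : ∀ {N k} → Vector ℂ N → Vec (Fin N) k → ℂ
monomial x []      = 1ℂ
monomial x (j ∷ α) = x j *ℂ monomial x α

-- 𝒜 xᵐ⁻¹, meaningful for order m ≥ 1.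
_⟨_⟩ : ∀ {m N} .{{_ : ℕ.NonZero m}} → Hypermatrix ℂ m N → Vector ℂ N → Vector ℂ N
_⟨_⟩ {suc k} A x i = ∑tuples k λ α → A (i ∷ α) *ℂ monomial x α

IsEigenvalue : ∀ {m N} .{{_ : ℕ.NonZero m}} → Hypermatrix ℂ m N → ℂ → Set
IsEigenvalue {m} {N} A μ = Σ (Vector ℂ N) λ x →
  ¬ (∀ i → x i ≃ℂ 0ℂ) ×
  (∀ i → (A ⟨ x ⟩) i ≃ℂ μ *ℂ (x i ^ℂ (m ∸ 1)))

NatMultiset : ℕ → Set
NatMultiset = Vector ℕ

#ₘ : ∀ {n} → NatMultiset n → ℕ
#ₘ = sumℕ

IsEmpty : ∀ {n} → NatMultiset n → Set
IsEmpty M = ∀ v → M v ≡ 0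

record HbGraph : Set where
  field
    order          : ℕ
    size           : ℕ
    {{V-nonempty}} : ℕ.NonZero order
    edge           : Fin size → NatMultiset order

open HbGraph public

NoRepeatedEdge : HbGraph → Set
NoRepeatedEdge H = ∀ i j → (∀ v → edge H i v ≡ edge H j v) → i ≡ j

NoEmptyEdge : HbGraph → Set
NoEmptyEdge H = ∀ i → ¬ IsEmpty (edge H i)

maximum : ∀ {k} → Vector ℕ k → ℕ
maximum = foldr ℕ._⊔_ 0

rank : HbGraph → ℕ
rank H = maximum λ i → #ₘ (edge H i)

data Kind : Set where
  straightforward silo layered : Kind

nulls : Kind → HbGraph → ℕ
nulls straightforward H = 1
nulls silo            H = rank H ∸ 1
nulls layered         H = rank H ∸ 1

dimension : Kind → HbGraph → ℕ
dimension κ H = order H ℕ.+ nulls κ H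

-- Multiplicities of the added indices in Mᵢ.  Null vertices are numbered from
-- 1 in the literature, so k stands for the (1 + k)-th of them.
added : ∀ κ H → Fin (size H) → NatMultiset (nulls κ H)
added straightforward H i k = rank H ∸ #ₘ (edge H i)
added silo            H i k = if ⌊ suc (toℕ k) ℕ.≟ #ₘ (edge H i) ⌋ then rank H ∸ #ₘ (edge H i) else 0
added layered         H i k = if ⌊ #ₘ (edge H i) ℕ.≤? suc (toℕ k) ⌋ then 1 else 0

uniformized : ∀ κ H → Fin (size H) → NatMultiset (dimension κ H)
uniformized κ H i = edge H i ++ added κ H i

-- The product runs over all vertices rather than the support, as 0! = 1.
multFactorials : ∀ {n} → NatMultiset n → ℕ
multFactorials M = productℕ λ v → M v !

value : Kind → (H : HbGraph) → Fin (size H) → ℚ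
value κ H i = (+ numerator κ ℚ./ ((rank H ∸ 1) !)) {{(rank H ∸ 1) ℕ.!≢0}}
  where
  numerator : Kind → ℕ
  numerator straightforward = multFactorials (edge H i) ℕ.* (rank H ∸ #ₘ (edge H i)) !
  numerator silo            = multFactorials (edge H i) ℕ.* (rank H ∸ #ₘ (edge H i)) !
  numerator layered         = multFactorials (edge H i)

-- The index tuple α is a permutation of the multiset M.
Arranges : ∀ {N m} → Vec (Fin N) m → NatMultiset N → Set
Arranges α M = ∀ j → Vec.count (j Fin.≟_) α ≡ M j

arranges? : ∀ {N m} (α : Vec (Fin N) m) (M : NatMultiset N) → Dec (Arranges α M)
arranges? α M = Fin.all? λ j → Vec.count (j Fin.≟_) α ℕ.≟ M j

contribution : ∀ κ H → Fin (size H) → Hypermatrix ℚ (rank H) (dimension κ H)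
contribution κ H i α = if ⌊ arranges? α (uniformized κ H i) ⌋ then value κ H i else 0ℚ

adjacencyTensor : ∀ κ H → Hypermatrix ℂ (rank H) (dimension κ H)
adjacencyTensor κ H α = ℚ→ℂ (sumℚ λ i → contribution κ H i α)

degₘ : (H : HbGraph) → Fin (order H) → ℕ
degₘ H v = sumℕ λ l → edge H l v

nullDegₘ : ∀ κ H → Fin (nulls κ H) → ℕ
nullDegₘ κ H k = sumℕ λ l → uniformized κ H l (order H ↑ʳ k)

Δ : HbGraph → ℕ
Δ H = maximum (degₘ H)

Δ⋆ : Kind → HbGraph → ℕ
Δ⋆ κ H = maximum (nullDegₘ κ H)

rank≢0 : ∀ H .{{_ : ℕ.NonZero (size H)}} → NoEmptyEdge H → ℕ.NonZero (rank H)
rank≢0 H ne = ℕ.≢-nonZero λ r≡0 → inhabited λ i → ne i λ v → ℕ.n≤0⇒n≡0 (ℕ.≤-trans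
  (term≤sum (edge H i) v)
  (ℕ.≤-trans (term≤maximum (λ j → #ₘ (edge H j)) i) (ℕ.≤-reflexive r≡0)))
  where
  inhabited : ∀ {n} .{{_ : ℕ.NonZero n}} → ¬ ¬ Fin n
  inhabited {suc _} ¬i = ¬i zero
  term≤sum : ∀ {n} (f : Vector ℕ n) i → f i ℕ.≤ sumℕ f
  term≤sum f zero    = ℕ.m≤m+n (f zero) _
  term≤sum f (suc i) = ℕ.≤-trans (term≤sum (λ j → f (suc j)) i) (ℕ.m≤n+m _ (f zero))
  term≤maximum : ∀ {n} (f : Vector ℕ n) i → f i ℕ.≤ maximum f
  term≤maximum f zero    = ℕ.m≤m⊔n (f zero) _
  term≤maximum f (suc i) = ℕ.≤-trans (term≤maximum (λ j → f (suc j)) i) (ℕ.m≤n⊔m (f zero) _)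

-- Geršgorin's argument: in the row of a coordinate of largest modulus, an eigenvalue of
-- a nonnegative tensor is bounded by the row sum.  A multiset M of size k has
-- k! / ∏ⱼ Mⱼ! arrangements, so the weight tᵢ makes row j of the contribution of eᵢ sum to
-- the multiplicity of j in Mᵢ, and row j of the whole tensor sums to at most the degree dⱼ.
--
-- Constructively the largest coordinate can only be chosen for the rational approximations
-- at a fixed index, so the estimate is carried out there, on squared moduli and with the
-- error of the eigenvalue equation as a perturbation.  It shows that if |μ| exceeded the
-- bound by a fixed margin, every coordinate of the eigenvector would converge to 0.

module Submission where

open import Data.Nat using (_+_; _⊔_; NonZero)
open import Defs

import Algebra.Definitions.RawSemiring as RawSemiringOps
open import Algebra.Bundles using (module CommutativeRing)
open import Data.Bool.Base using (if_then_else_)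
open import Data.Fin.Base using (Fin; zero; suc; toℕ; fromℕ<; splitAt; join; _↑ˡ_)
import Data.Fin.Properties as Fin
open import Data.Integer.Base as ℤ using (+_)
import Data.Integer.Properties as ℤ
open import Data.Nat.Base as ℕ using (ℕ; zero; suc; pred; _∸_; _!; z≤n)
import Data.Nat.Properties as ℕ
open import Data.Product.Base using (∃; _×_; _,_; proj₁; proj₂)
open import Data.Rational.Base as ℚ using (ℚ; 0ℚ; 1ℚ; ½; toℚᵘ)
import Data.Rational.Properties as ℚ
open import Data.Rational.Solver using (module +-*-Solver)
import Data.Rational.Unnormalised.Base as ℚᵘ
import Data.Rational.Unnormalised.Properties as ℚᵘ
open import Data.Sum.Base as Sum using (_⊎_; inj₁; inj₂)
open import Data.Sum.Properties using ([,]-map)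
open import Data.Vec.Base using (Vec; []; _∷_)
open import Data.Vec.Functional using (Vector; updateAt; _++_)
open import Data.Vec.Functional.Properties using (updateAt-updates; updateAt-minimal; lookup-++ˡ)
open import Relation.Binary.PropositionalEquality
open import Relation.Nullary using (¬_; Dec; yes; no; contradiction)
open import Relation.Nullary.Decidable using (⌊_⌋)

open import Algebra.Properties.CommutativeMonoid.Sum ℕ.*-1-commutativeMonoid
  using () renaming (sum-cong-≗ to productℕ-cong)
open import Algebra.Properties.CommutativeMonoid.Sum ℚ.+-0-commutativeMonoid
  using () renaming (∑-comm to ∑ℚ-comm; sum-cong-≗ to sumℚ-cong)
open import Algebra.Properties.CommutativeSemigroup ℕ.*-commutativeSemigroup using (x∙yz≈y∙xz)
open import Algebra.Properties.CommutativeSemiring.Exp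
  (CommutativeRing.commutativeSemiring ℚ.+-*-commutativeRing) using (^-distrib-*)
open import Algebra.Properties.Monoid.Mult ℚ.+-0-monoid using (×-homo-+)
open import Algebra.Properties.Semiring.Sum ℕ.+-*-semiring
  using () renaming (*-distribʳ-sum to *-distribʳ-sumℕ; sum-cong-≗ to sumℕ-cong)

open RawSemiringOps ℕ.+-*-rawSemiring using () renaming (sum to sumℕ)
open RawSemiringOps ℚ.+-*-rawSemiring using () renaming (_×_ to _·_; _^_ to _^ℚ_; sum to sumℚ)
open RawSemiringOps ℂ-rawSemiring using () renaming (_^_ to _^ℂ_; sum to sumℂ)
open +-*-Solver using (solve; con; _:+_; _:*_; _:-_; :-_; _:=_)
open RationalFacts
open Bisection using (bisect√-brackets; module Brackets)

-- Counting arrangements of a multiset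

sumℕ-mono : ∀ {n} {f g : Vector ℕ n} → (∀ i → f i ℕ.≤ g i) → sumℕ f ℕ.≤ sumℕ g
sumℕ-mono {zero}  f≤g = z≤n
sumℕ-mono {suc n} f≤g = ℕ.+-mono-≤ (f≤g zero) (sumℕ-mono λ i → f≤g (suc i))

sumℕ-zero : ∀ {n} {f : Vector ℕ n} → (∀ i → f i ≡ 0) → sumℕ f ≡ 0
sumℕ-zero {zero}  f≡0 = refl
sumℕ-zero {suc n} f≡0 = cong₂ ℕ._+_ (f≡0 zero) (sumℕ-zero λ i → f≡0 (suc i))

∑tuplesℕ : ∀ {N} k → (Vec (Fin N) k → ℕ) → ℕ
∑tuplesℕ zero    f = f []
∑tuplesℕ (suc k) f = sumℕ λ j → ∑tuplesℕ k λ α → f (j ∷ α)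

∑tuplesℕ-mono : ∀ {N} k {f g : Vec (Fin N) k → ℕ} → (∀ α → f α ℕ.≤ g α) → ∑tuplesℕ k f ℕ.≤ ∑tuplesℕ k g
∑tuplesℕ-mono zero    f≤g = f≤g []
∑tuplesℕ-mono (suc k) f≤g = sumℕ-mono λ j → ∑tuplesℕ-mono k λ α → f≤g (j ∷ α)

∑tuplesℕ-zero : ∀ {N} k {f : Vec (Fin N) k → ℕ} → (∀ α → f α ≡ 0) → ∑tuplesℕ k f ≡ 0
∑tuplesℕ-zero zero    f≡0 = f≡0 []
∑tuplesℕ-zero (suc k) f≡0 = sumℕ-zero λ j → ∑tuplesℕ-zero k λ α → f≡0 (j ∷ α)

indicator : ∀ {P : Set} → Dec P → ℕ
indicator P? = if ⌊ P? ⌋ then 1 else 0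

indicator-mono : ∀ {P Q : Set} (P? : Dec P) (Q? : Dec Q) → (P → Q) → indicator P? ℕ.≤ indicator Q?
indicator-mono (no _)  _       _   = z≤n
indicator-mono (yes _) (yes _) _   = ℕ.≤-refl
indicator-mono (yes p) (no ¬q) P→Q = contradiction (P→Q p) ¬q

indicator-false : ∀ {P : Set} (P? : Dec P) → ¬ P → indicator P? ≡ 0
indicator-false (yes p) ¬p = contradiction p ¬p
indicator-false (no _)  _  = refl

-- Since `pred` sends 0 to 0, an occurrence is really deleted only when `M i ≢ 0`; hence that
-- hypothesis in the lemmas on `remove`.
remove : ∀ {N} → Fin N → NatMultiset N → NatMultiset N
remove i M = updateAt M i pred

#ₘ-remove : ∀ {N} (i : Fin N) (M : NatMultiset N) → M i ≢ 0 → #ₘ M ≡ suc (#ₘ (remove i M))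
#ₘ-remove zero    M M₀≢0 = cong (ℕ._+ sumℕ (λ j → M (suc j))) (sym (ℕ.suc-pred (M zero) {{ℕ.≢-nonZero M₀≢0}}))
#ₘ-remove (suc i) M Mᵢ≢0 =
  trans (cong (M zero ℕ.+_) (#ₘ-remove i (λ j → M (suc j)) Mᵢ≢0)) (ℕ.+-suc (M zero) _)

multFactorials-remove : ∀ {N} (i : Fin N) (M : NatMultiset N) → M i ≢ 0 →
                        multFactorials M ≡ M i ℕ.* multFactorials (remove i M)
multFactorials-remove zero M M₀≢0 with M zero
... | zero  = contradiction refl M₀≢0
... | suc m = ℕ.*-assoc (suc m) (m !) _
multFactorials-remove (suc i) M Mᵢ≢0 =
  trans (cong (M zero ! ℕ.*_) (multFactorials-remove i (λ j → M (suc j)) Mᵢ≢0))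
        (x∙yz≈y∙xz (M zero !) (M (suc i)) _)

multFactorials-empty : ∀ {N} (M : NatMultiset N) → IsEmpty M → multFactorials M ≡ 1
multFactorials-empty {zero}  M M≡0 = refl
multFactorials-empty {suc N} M M≡0 = cong₂ ℕ._*_ (cong _! (M≡0 zero))
  (multFactorials-empty (λ j → M (suc j)) λ j → M≡0 (suc j))

-- The head `i` counts itself, so `M i` is positive, and dropping the head lowers the count of `i`
-- by one and leaves all other counts alone.
arranges-∷⁻ : ∀ {N m} (i : Fin N) (α : Vec (Fin N) m) (M : NatMultiset N) →
              Arranges (i ∷ α) M → M i ≢ 0 × Arranges α (remove i M)
arranges-∷⁻ i α M arr = Mᵢ≢0 , arr′
  where
  arr′ : Arranges α (remove i M)
  arr′ j with j Fin.≟ i | arr j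
  ... | yes refl | eq = trans (cong pred eq) (sym (updateAt-updates i M))
  ... | no  j≢i  | eq = trans eq (sym (updateAt-minimal j i M j≢i))
  Mᵢ≢0 : M i ≢ 0
  Mᵢ≢0 Mᵢ≡0 with i Fin.≟ i | arr i
  ... | yes _  | eq = ℕ.1+n≢0 (trans eq Mᵢ≡0)
  ... | no i≢i | _  = i≢i refl

arranges⇒#ₘ≡ : ∀ {N m} (α : Vec (Fin N) m) (M : NatMultiset N) → Arranges α M → #ₘ M ≡ m
arranges⇒#ₘ≡ []      M arr = sumℕ-zero λ j → sym (arr j)
arranges⇒#ₘ≡ (i ∷ α) M arr =
  let (Mᵢ≢0 , arr′) = arranges-∷⁻ i α M arr
  in trans (#ₘ-remove i M Mᵢ≢0) (cong suc (arranges⇒#ₘ≡ α (remove i M) arr′))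

-- A multinomial coefficient: `k !` divided by `multFactorials M` if `#ₘ M` is `k`, and 0 otherwise.
arrangements : ∀ {N} k → NatMultiset N → ℕ
arrangements k M = ∑tuplesℕ k λ α → indicator (arranges? α M)

arrangementsFrom : ∀ {N} → Fin N → ∀ k → NatMultiset N → ℕ
arrangementsFrom i k M = ∑tuplesℕ k λ α → indicator (arranges? (i ∷ α) M)

mutual

  -- The multinomial formula with its denominator cleared. Tuples are sorted by their first index
  -- `i`; those starting with `i` account for at most `M i * k !`, and these terms add up to
  -- `#ₘ M * k !`, which is `suc k !` when the sizes agree. When they disagree nothing is counted.
  arrangements-bound : ∀ {N} k (M : NatMultiset N) → arrangements k M ℕ.* multFactorials M ℕ.≤ k !
  arrangements-bound zero M with arranges? [] M
  -- The empty tuple arranges only the empty multiset, whose factorial product is 1.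
  ... | yes arr = ℕ.≤-reflexive (trans (ℕ.*-identityˡ _) (multFactorials-empty M λ j → sym (arr j)))
  ... | no  _   = z≤n
  arrangements-bound (suc k) M with #ₘ M ℕ.≟ suc k
  ... | yes #M≡1+k = begin
    arrangements (suc k) M ℕ.* multFactorials M
      ≡⟨ *-distribʳ-sumℕ (multFactorials M) (λ i → arrangementsFrom i k M) ⟩
    sumℕ (λ i → arrangementsFrom i k M ℕ.* multFactorials M)
      ≤⟨ sumℕ-mono (λ i → arrangementsFrom-bound i k M) ⟩
    sumℕ (λ i → M i ℕ.* k !)
      ≡⟨ *-distribʳ-sumℕ (k !) M ⟨
    #ₘ M ℕ.* k !
      ≡⟨ cong (ℕ._* k !) #M≡1+k ⟩
    suc k ! ∎
    where open ℕ.≤-Reasoning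
  ... | no  #M≢1+k = subst (ℕ._≤ suc k !)
    (sym (cong (ℕ._* multFactorials M) (∑tuplesℕ-zero (suc k) λ α →
      indicator-false (arranges? α M) λ arr → #M≢1+k (arranges⇒#ₘ≡ α M arr)))) z≤n

  -- Dropping the head turns such a tuple into an arrangement of `remove i M`, whose factorial
  -- product is smaller by exactly the factor `M i`. If `M i` is 0, no arrangement starts with `i`.
  arrangementsFrom-bound : ∀ {N} i k (M : NatMultiset N) →
                           arrangementsFrom i k M ℕ.* multFactorials M ℕ.≤ M i ℕ.* k !
  arrangementsFrom-bound i k M with M i ℕ.≟ 0
  ... | yes Mᵢ≡0 = subst (ℕ._≤ M i ℕ.* k !)
    (sym (cong (ℕ._* multFactorials M) (∑tuplesℕ-zero k λ α →
      indicator-false (arranges? (i ∷ α) M) λ arr → proj₁ (arranges-∷⁻ i α M arr) Mᵢ≡0))) z≤n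
  ... | no  Mᵢ≢0 = begin
    arrangementsFrom i k M ℕ.* multFactorials M
      ≤⟨ ℕ.*-monoˡ-≤ (multFactorials M) (∑tuplesℕ-mono k λ α →
           indicator-mono (arranges? (i ∷ α) M) (arranges? α M⁻) λ arr → proj₂ (arranges-∷⁻ i α M arr)) ⟩
    arrangements k M⁻ ℕ.* multFactorials M
      ≡⟨ cong (arrangements k M⁻ ℕ.*_) (multFactorials-remove i M Mᵢ≢0) ⟩
    arrangements k M⁻ ℕ.* (M i ℕ.* multFactorials M⁻)
      ≡⟨ x∙yz≈y∙xz (arrangements k M⁻) (M i) (multFactorials M⁻) ⟩
    M i ℕ.* (arrangements k M⁻ ℕ.* multFactorials M⁻)
      ≤⟨ ℕ.*-monoʳ-≤ (M i) (arrangements-bound k M⁻) ⟩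
    M i ℕ.* k ! ∎
    where
    open ℕ.≤-Reasoning
    M⁻ = remove i M

-- Row sums

sumℚ-mono : ∀ {n} {f g : Vector ℚ n} → (∀ i → f i ℚ.≤ g i) → sumℚ f ℚ.≤ sumℚ g
sumℚ-mono {zero}  f≤g = ℚ.≤-refl
sumℚ-mono {suc n} f≤g = ℚ.+-mono-≤ (f≤g zero) (sumℚ-mono λ i → f≤g (suc i))

∑tuplesℚ : ∀ {N} k → (Vec (Fin N) k → ℚ) → ℚ
∑tuplesℚ zero    f = f []
∑tuplesℚ (suc k) f = sumℚ λ j → ∑tuplesℚ k λ α → f (j ∷ α)

∑tuplesℚ-∑-comm : ∀ {N p} k (f : Fin p → Vec (Fin N) k → ℚ) →
                  ∑tuplesℚ k (λ α → sumℚ λ l → f l α) ≡ sumℚ λ l → ∑tuplesℚ k (f l)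
∑tuplesℚ-∑-comm zero    f = refl
∑tuplesℚ-∑-comm (suc k) f = trans
  (sumℚ-cong λ j → ∑tuplesℚ-∑-comm k λ l α → f l (j ∷ α))
  (∑ℚ-comm λ j l → ∑tuplesℚ k λ α → f l (j ∷ α))

sum-· : ∀ {n} (f : Vector ℕ n) q → sumℚ (λ i → f i · q) ≡ sumℕ f · q
sum-· {zero}  f q = refl
sum-· {suc n} f q = trans (cong (f zero · q ℚ.+_) (sum-· (λ i → f (suc i)) q))
  (sym (×-homo-+ q (f zero) _))

∑tuplesℚ-indicator : ∀ {N} k {P : Vec (Fin N) k → Set} (P? : ∀ α → Dec (P α)) q →
  ∑tuplesℚ k (λ α → if ⌊ P? α ⌋ then q else 0ℚ) ≡ ∑tuplesℕ k (λ α → indicator (P? α)) · q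
∑tuplesℚ-indicator zero P? q with P? []
... | yes _ = sym (ℚ.+-identityʳ q)
... | no  _ = refl
∑tuplesℚ-indicator (suc k) P? q = trans
  (sumℚ-cong λ j → ∑tuplesℚ-indicator k (λ α → P? (j ∷ α)) q)
  (sum-· (λ j → ∑tuplesℕ k λ α → indicator (P? (j ∷ α))) q)

-- Spelled as in `fromℕ`, so that the final estimate has literally the form of the claimed bound.
ι : ℕ → ℚ
ι n = + n ℚ./ 1

ι≡·1 : ∀ n → ι n ≡ n · 1ℚ
ι≡·1 n = ℚ.toℚᵘ-injective (begin-equality
  toℚᵘ (ι n)                  ≃⟨ ℚ.toℚᵘ-fromℚᵘ (+ n ℚᵘ./ 1) ⟩
  + n ℚᵘ./ 1                  ≃⟨ ℚᵘ.*-identityʳ (+ n ℚᵘ./ 1) ⟨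
  (+ n ℚᵘ./ 1) ℚᵘ.* ℚᵘ.1ℚᵘ    ≃⟨ ·-toℚᵘ n 1ℚ ⟨
  toℚᵘ (n · 1ℚ)               ∎)
  where open ℚᵘ.≤-Reasoning

ι-+ : ∀ m n → ι (m ℕ.+ n) ≡ ι m ℚ.+ ι n
ι-+ m n = begin
  ι (m ℕ.+ n)            ≡⟨ ι≡·1 (m ℕ.+ n) ⟩
  (m ℕ.+ n) · 1ℚ         ≡⟨ ×-homo-+ 1ℚ m n ⟩
  m · 1ℚ ℚ.+ n · 1ℚ      ≡⟨ cong₂ ℚ._+_ (ι≡·1 m) (ι≡·1 n) ⟨
  ι m ℚ.+ ι n            ∎
  where open ≡-Reasoning

0≤/ : ∀ n d .{{_ : ℕ.NonZero d}} → 0ℚ ℚ.≤ + n ℚ./ d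
0≤/ n d = ℚ.nonNegative⁻¹ (+ n ℚ./ d) {{ℚ.normalize-nonNeg n d}}

ι-mono : ∀ {m n} → m ℕ.≤ n → ι m ℚ.≤ ι n
ι-mono {m} {n} m≤n = begin
  ι m                    ≡⟨ ℚ.+-identityʳ (ι m) ⟨
  ι m ℚ.+ 0ℚ             ≤⟨ ℚ.+-monoʳ-≤ (ι m) (0≤/ (n ∸ m) 1) ⟩
  ι m ℚ.+ ι (n ∸ m)      ≡⟨ ι-+ m (n ∸ m) ⟨
  ι (m ℕ.+ (n ∸ m))      ≡⟨ cong ι (ℕ.m+[n∸m]≡n m≤n) ⟩
  ι n                    ∎
  where open ℚ.≤-Reasoning

sum-ι : ∀ {n} (f : Vector ℕ n) → sumℚ (λ i → ι (f i)) ≡ ι (sumℕ f)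
sum-ι {zero}  f = refl
sum-ι {suc n} f = trans (cong (ι (f zero) ℚ.+_) (sum-ι (λ i → f (suc i)))) (sym (ι-+ (f zero) _))

-- Normalised fractions do not compute well on variables; over the unnormalised ones the claim is
-- the cross-multiplied hypothesis.
·-/-≤ : ∀ c w b d .{{_ : ℕ.NonZero d}} → c ℕ.* w ℕ.≤ b ℕ.* d → c · (+ w ℚ./ d) ℚ.≤ ι b
·-/-≤ c w b d@(suc _) cw≤bd = ℚ.toℚᵘ-cancel-≤ (begin
  toℚᵘ (c · (+ w ℚ./ d))                   ≃⟨ ·-toℚᵘ c (+ w ℚ./ d) ⟩
  (+ c ℚᵘ./ 1) ℚᵘ.* toℚᵘ (+ w ℚ./ d)       ≃⟨ ℚᵘ.*-congˡ {+ c ℚᵘ./ 1} (ℚ.toℚᵘ-fromℚᵘ (+ w ℚᵘ./ d)) ⟩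
  (+ c ℚᵘ./ 1) ℚᵘ.* (+ w ℚᵘ./ d)           ≤⟨ ℚᵘ.*≤* cross ⟩
  + b ℚᵘ./ 1                               ≃⟨ ℚ.toℚᵘ-fromℚᵘ (+ b ℚᵘ./ 1) ⟨
  toℚᵘ (ι b)                               ∎)
  where
  open ℚᵘ.≤-Reasoning
  cross : + c ℤ.* + w ℤ.* + 1 ℤ.≤ + b ℤ.* + (1 ℕ.* d)
  cross = subst₂ ℤ._≤_
    (trans (ℤ.pos-* c w) (sym (ℤ.*-identityʳ _)))
    (trans (ℤ.pos-* b d) (cong (λ e → + b ℤ.* + e) (sym (ℕ.*-identityˡ d))))
    (ℤ.+≤+ cw≤bd)

rowSum : ∀ {m N} .{{_ : ℕ.NonZero m}} → Hypermatrix ℚ m N → Fin N → ℚ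
rowSum {suc k} a i = ∑tuplesℚ k λ α → a (i ∷ α)

-- After exchanging the two sums, each `M l` contributes the number of its arrangements with head
-- `i` times a constant weight, and `arrangementsFrom-bound` applies. Bounding `w l` by the
-- factorial product treats all three kinds of tensor at once.
rowSum-mult : ∀ {m N p} .{{_ : ℕ.NonZero m}} (M : Fin p → NatMultiset N) (w : Fin p → ℕ) →
  (∀ l → w l ℕ.≤ multFactorials (M l)) → ∀ i →
  rowSum {m} (λ α → sumℚ λ l → if ⌊ arranges? α (M l) ⌋ then (+ w l ℚ./ ((m ∸ 1) !)) {{(m ∸ 1) ℕ.!≢0}} else 0ℚ) i
    ℚ.≤ ι (sumℕ λ l → M l i)
rowSum-mult {suc k} M w w≤ i = begin
  ∑tuplesℚ k (λ α → sumℚ λ l → if ⌊ arranges? (i ∷ α) (M l) ⌋ then v l else 0ℚ)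
    ≡⟨ ∑tuplesℚ-∑-comm k (λ l α → if ⌊ arranges? (i ∷ α) (M l) ⌋ then v l else 0ℚ) ⟩
  sumℚ (λ l → ∑tuplesℚ k λ α → if ⌊ arranges? (i ∷ α) (M l) ⌋ then v l else 0ℚ)
    ≡⟨ sumℚ-cong (λ l → ∑tuplesℚ-indicator k (λ α → arranges? (i ∷ α) (M l)) (v l)) ⟩
  sumℚ (λ l → arrangementsFrom i k (M l) · v l)
    ≤⟨ sumℚ-mono (λ l → ·-/-≤ (arrangementsFrom i k (M l)) (w l) (M l i) (k !) {{k ℕ.!≢0}} (ℕ.≤-trans
         (ℕ.*-monoʳ-≤ (arrangementsFrom i k (M l)) (w≤ l)) (arrangementsFrom-bound i k (M l)))) ⟩
  sumℚ (λ l → ι (M l i))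
    ≡⟨ sum-ι (λ l → M l i) ⟩
  ι (sumℕ λ l → M l i) ∎
  where
  open ℚ.≤-Reasoning
  v : _ → ℚ
  v l = (+ w l ℚ./ (k !)) {{k ℕ.!≢0}}

-- Geršgorin's bound

≤⇒≯ : ∀ {p q} → p ℚ.≤ q → ¬ q ℚ.< p
≤⇒≯ p≤q q<p = ℚ.<-irrefl refl (ℚ.≤-<-trans p≤q q<p)

0≤p*p : ∀ p → 0ℚ ℚ.≤ p ℚ.* p
0≤p*p p with ℚ.≤-total 0ℚ p
... | inj₁ 0≤p = 0≤* 0≤p 0≤p
... | inj₂ p≤0 = subst (0ℚ ℚ.≤_) (solve 1 (λ p → (:- p) :* (:- p) := p :* p) refl p)
  (0≤* (ℚ.neg-antimono-≤ {p} {0ℚ} p≤0) (ℚ.neg-antimono-≤ {p} {0ℚ} p≤0))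

p≤p+q : ∀ p {q} → 0ℚ ℚ.≤ q → p ℚ.≤ p ℚ.+ q
p≤p+q p 0≤q = ℚ.≤-trans (ℚ.≤-reflexive (sym (ℚ.+-identityʳ p))) (ℚ.+-monoʳ-≤ p 0≤q)

p*p≤q*q⇒p≤q : ∀ {p q} → 0ℚ ℚ.≤ q → p ℚ.* p ℚ.≤ q ℚ.* q → p ℚ.≤ q
p*p≤q*q⇒p≤q {p} {q} 0≤q p²≤q² with p ℚ.≤? q
... | yes p≤q = p≤q
... | no  p≰q = contradiction (begin-strict
  q ℚ.* q  ≤⟨ ℚ.*-monoʳ-≤-nonNeg q {{ℚ.nonNegative 0≤q}} (ℚ.<⇒≤ q<p) ⟩
  p ℚ.* q  <⟨ ℚ.*-monoʳ-<-pos p {{ℚ.positive (ℚ.≤-<-trans 0≤q q<p)}} q<p ⟩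
  p ℚ.* p  ∎) (≤⇒≯ p²≤q²)
  where
  open ℚ.≤-Reasoning
  q<p = ℚ.≰⇒> p≰q

0≤^ : ∀ {p} k → 0ℚ ℚ.≤ p → 0ℚ ℚ.≤ p ^ℚ k
0≤^ zero    0≤p = ℚ.nonNegative⁻¹ 1ℚ
0≤^ (suc k) 0≤p = 0≤* 0≤p (0≤^ k 0≤p)

0<* : ∀ {p q} → 0ℚ ℚ.< p → 0ℚ ℚ.< q → 0ℚ ℚ.< p ℚ.* q
0<* {p} {q} 0<p 0<q =
  ℚ.positive⁻¹ (p ℚ.* q) {{ℚ.pos*pos⇒pos p {{ℚ.positive 0<p}} q {{ℚ.positive 0<q}}}}

0<^ : ∀ {p} k → 0ℚ ℚ.< p → 0ℚ ℚ.< p ^ℚ k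
0<^ zero    0<p = ℚ.positive⁻¹ 1ℚ
0<^ (suc k) 0<p = 0<* 0<p (0<^ k 0<p)

^-mono-≤ : ∀ {p q} k → 0ℚ ℚ.≤ p → p ℚ.≤ q → p ^ℚ k ℚ.≤ q ^ℚ k
^-mono-≤ zero    0≤p p≤q = ℚ.≤-refl
^-mono-≤ (suc k) 0≤p p≤q = *-mono-≤ 0≤p (0≤^ k (ℚ.≤-trans 0≤p p≤q)) p≤q (^-mono-≤ k 0≤p p≤q)

^-cancel-< : ∀ {p q} k → 0ℚ ℚ.≤ q → p ^ℚ k ℚ.< q ^ℚ k → p ℚ.< q
^-cancel-< {p} {q} k 0≤q pᵏ<qᵏ with q ℚ.≤? p
... | yes q≤p = contradiction pᵏ<qᵏ (≤⇒≯ (^-mono-≤ k 0≤q q≤p))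
... | no  q≰p = ℚ.≰⇒> q≰p

-- The argument in `Fin n` guarantees that there is an index to choose.
argmax : ∀ {n} → Fin n → (f : Vector ℚ n) → ∃ λ i → ∀ j → f j ℚ.≤ f i
argmax {suc zero}    _ f = zero , λ { zero → ℚ.≤-refl }
argmax {suc (suc n)} _ f with argmax zero (λ i → f (suc i))
... | i , max with ℚ.≤-total (f zero) (f (suc i))
...   | inj₁ f₀≤ = suc i , λ { zero → f₀≤ ; (suc j) → max j }
...   | inj₂ ≤f₀ = zero , λ { zero → ℚ.≤-refl ; (suc j) → ℚ.≤-trans (max j) ≤f₀ }

-- A common threshold is required because the coordinate of largest modulus may change with the
-- approximation index.
eventually-∀ : ∀ {n} {P : Fin n → ℕ → Set} → (∀ i → ∃ λ K → ∀ k → K ℕ.≤ k → P i k) →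
               ∃ λ K → ∀ k → K ℕ.≤ k → ∀ i → P i k
eventually-∀ {zero}  ev = 0 , λ _ _ ()
eventually-∀ {suc n} ev with ev zero | eventually-∀ (λ i → ev (suc i))
... | K , h | L , g = K ℕ.⊔ L , λ
  { k le zero    → h k (ℕ.m⊔n≤o⇒m≤o K L le)
  ; k le (suc i) → g k (ℕ.m⊔n≤o⇒n≤o K L le) i }

-- Squared moduli of rational approximations

norm : ℚ → ℚ → ℚ
norm a b = a ℚ.* a ℚ.+ b ℚ.* b

0≤norm : ∀ a b → 0ℚ ℚ.≤ norm a b
0≤norm a b = 0≤+ (0≤p*p a) (0≤p*p b)

-- Minkowski's inequality with the square roots cleared.
norm-+ : ∀ {a b c d s t q} → 0ℚ ℚ.≤ s → 0ℚ ℚ.≤ t → 0ℚ ℚ.≤ q →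
         norm a b ℚ.≤ s ℚ.* s ℚ.* q → norm c d ℚ.≤ t ℚ.* t ℚ.* q →
         norm (a ℚ.+ c) (b ℚ.+ d) ℚ.≤ (s ℚ.+ t) ℚ.* (s ℚ.+ t) ℚ.* q
norm-+ {a} {b} {c} {d} {s} {t} {q} 0≤s 0≤t 0≤q ab≤ cd≤ = begin
  norm (a ℚ.+ c) (b ℚ.+ d)
    ≡⟨ solve 4 (λ a b c d → (a :+ c) :* (a :+ c) :+ (b :+ d) :* (b :+ d) :=
         (a :* a :+ b :* b) :+ (c :* c :+ d :* d) :+ ((a :* c :+ b :* d) :+ (a :* c :+ b :* d))) refl a b c d ⟩
  norm a b ℚ.+ norm c d ℚ.+ (p ℚ.+ p)
    ≤⟨ ℚ.+-mono-≤ (ℚ.+-mono-≤ ab≤ cd≤) (ℚ.+-mono-≤ p≤ p≤) ⟩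
  s ℚ.* s ℚ.* q ℚ.+ t ℚ.* t ℚ.* q ℚ.+ (s ℚ.* t ℚ.* q ℚ.+ s ℚ.* t ℚ.* q)
    ≡⟨ solve 3 (λ s t q → s :* s :* q :+ t :* t :* q :+ (s :* t :* q :+ s :* t :* q) :=
         (s :+ t) :* (s :+ t) :* q) refl s t q ⟩
  (s ℚ.+ t) ℚ.* (s ℚ.+ t) ℚ.* q ∎
  where
  open ℚ.≤-Reasoning
  p = a ℚ.* c ℚ.+ b ℚ.* d
  -- The other half of Lagrange's identity: `p * p + w * w` is the product of the two norms, which
  -- yields the Cauchy-Schwarz bound on `p`.
  w = a ℚ.* d ℚ.- b ℚ.* c
  p≤ : p ℚ.≤ s ℚ.* t ℚ.* q
  p≤ = p*p≤q*q⇒p≤q (0≤* (0≤* 0≤s 0≤t) 0≤q) (begin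
    p ℚ.* p
      ≤⟨ p≤p+q (p ℚ.* p) (0≤p*p w) ⟩
    p ℚ.* p ℚ.+ w ℚ.* w
      ≡⟨ solve 4 (λ a b c d → (a :* c :+ b :* d) :* (a :* c :+ b :* d) :+ (a :* d :- b :* c) :* (a :* d :- b :* c) :=
           (a :* a :+ b :* b) :* (c :* c :+ d :* d)) refl a b c d ⟩
    norm a b ℚ.* norm c d
      ≤⟨ *-mono-≤ (0≤norm a b) (0≤* (0≤* 0≤t 0≤t) 0≤q) ab≤ cd≤ ⟩
    s ℚ.* s ℚ.* q ℚ.* (t ℚ.* t ℚ.* q)
      ≡⟨ solve 3 (λ s t q → s :* s :* q :* (t :* t :* q) := s :* t :* q :* (s :* t :* q)) refl s t q ⟩
    s ℚ.* t ℚ.* q ℚ.* (s ℚ.* t ℚ.* q) ∎)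

normAt : ℕ → ℂ → ℚ
normAt n z = norm (seq (re z) n) (seq (im z) n)

-- Multiplicativity is exact at each index, since the operations act termwise: it is the two-square
-- identity.
normAt-* : ∀ n z w → normAt n (z *ℂ w) ≡ normAt n z ℚ.* normAt n w
normAt-* n z w = solve 4
  (λ a b c d → (a :* c :+ (:- (b :* d))) :* (a :* c :+ (:- (b :* d))) :+ (a :* d :+ b :* c) :* (a :* d :+ b :* c) :=
    (a :* a :+ b :* b) :* (c :* c :+ d :* d)) refl
  (seq (re z) n) (seq (im z) n) (seq (re w) n) (seq (im w) n)

normAt-ℚ→ℂ-* : ∀ n q z → normAt n (ℚ→ℂ q *ℂ z) ≡ q ℚ.* q ℚ.* normAt n z
normAt-ℚ→ℂ-* n q z = trans (normAt-* n (ℚ→ℂ q) z) (cong (ℚ._* normAt n z) (ℚ.+-identityʳ (q ℚ.* q)))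

normAt-^ : ∀ n z k → normAt n (z ^ℂ k) ≡ normAt n z ^ℚ k
normAt-^ n z zero    = refl
normAt-^ n z (suc k) = trans (normAt-* n z (z ^ℂ k)) (cong (normAt n z ℚ.*_) (normAt-^ n z k))

0≤sumℚ : ∀ {n} {f : Vector ℚ n} → (∀ i → 0ℚ ℚ.≤ f i) → 0ℚ ℚ.≤ sumℚ f
0≤sumℚ {zero}  0≤f = ℚ.≤-refl
0≤sumℚ {suc n} 0≤f = 0≤+ (0≤f zero) (0≤sumℚ λ i → 0≤f (suc i))

0≤∑tuplesℚ : ∀ {N} k {f : Vec (Fin N) k → ℚ} → (∀ α → 0ℚ ℚ.≤ f α) → 0ℚ ℚ.≤ ∑tuplesℚ k f
0≤∑tuplesℚ zero    0≤f = 0≤f []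
0≤∑tuplesℚ (suc k) 0≤f = 0≤sumℚ λ j → 0≤∑tuplesℚ k λ α → 0≤f (j ∷ α)

module _ (n : ℕ) {q : ℚ} (0≤q : 0ℚ ℚ.≤ q) where

  -- The triangle inequality by iterating `norm-+`. Here `q` is the square of a common scale, so a
  -- modulus bound `s` times that scale appears as `s * s * q` and no root is extracted.
  normAt-sum : ∀ {N} (f : Vector ℂ N) (s : Vector ℚ N) → (∀ j → 0ℚ ℚ.≤ s j) →
    (∀ j → normAt n (f j) ℚ.≤ s j ℚ.* s j ℚ.* q) → normAt n (sumℂ f) ℚ.≤ sumℚ s ℚ.* sumℚ s ℚ.* q
  normAt-sum {zero}  f s 0≤s f≤ = 0≤* {0ℚ} ℚ.≤-refl 0≤q
  normAt-sum {suc N} f s 0≤s f≤ =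
    norm-+ {seq (re (f zero)) n} {seq (im (f zero)) n} {seq (re f′) n} {seq (im f′) n}
      (0≤s zero) (0≤sumℚ λ j → 0≤s (suc j)) 0≤q (f≤ zero)
      (normAt-sum (λ j → f (suc j)) (λ j → s (suc j)) (λ j → 0≤s (suc j)) (λ j → f≤ (suc j)))
    where f′ = sumℂ λ j → f (suc j)

  normAt-∑tuples : ∀ {N} k (f : Vec (Fin N) k → ℂ) (s : Vec (Fin N) k → ℚ) → (∀ α → 0ℚ ℚ.≤ s α) →
    (∀ α → normAt n (f α) ℚ.≤ s α ℚ.* s α ℚ.* q) →
    normAt n (∑tuples k f) ℚ.≤ ∑tuplesℚ k s ℚ.* ∑tuplesℚ k s ℚ.* q
  normAt-∑tuples zero    f s 0≤s f≤ = f≤ []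
  normAt-∑tuples (suc k) f s 0≤s f≤ = normAt-sum (λ j → ∑tuples k λ α → f (j ∷ α)) (λ j → ∑tuplesℚ k λ α → s (j ∷ α))
    (λ j → 0≤∑tuplesℚ k λ α → 0≤s (j ∷ α))
    (λ j → normAt-∑tuples k (λ α → f (j ∷ α)) (λ α → s (j ∷ α)) (λ α → 0≤s (j ∷ α)) (λ α → f≤ (j ∷ α)))

normAt-monomial : ∀ n {N k q} (x : Vector ℂ N) (α : Vec (Fin N) k) → 0ℚ ℚ.≤ q →
  (∀ j → normAt n (x j) ℚ.≤ q) → normAt n (monomial x α) ℚ.≤ q ^ℚ k
normAt-monomial n x []      0≤q x≤ = ℚ.≤-refl
normAt-monomial n {k = suc k} x (j ∷ α) 0≤q x≤ = subst (ℚ._≤ _) (sym (normAt-* n (x j) (monomial x α)))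
  (*-mono-≤ (0≤norm (seq (re (x j)) n) (seq (im (x j)) n)) (0≤^ k 0≤q) (x≤ j) (normAt-monomial n x α 0≤q x≤))

∣p∣≤ : ∀ {p q} → 0ℚ ℚ.≤ q → p ℚ.* p ℚ.≤ q ℚ.* q → ℚ.∣ p ∣ ℚ.≤ q
∣p∣≤ {p} 0≤q p²≤q² = p*p≤q*q⇒p≤q 0≤q (subst (ℚ._≤ _)
  (trans (sym (ℚ.0≤p⇒∣p∣≡p (0≤p*p p))) (ℚ.∣p*q∣≡∣p∣*∣q∣ p p)) p²≤q²)

∣p∣≤⇒p*p≤ : ∀ {p q} → ℚ.∣ p ∣ ℚ.≤ q → p ℚ.* p ℚ.≤ q ℚ.* q
∣p∣≤⇒p*p≤ {p} {q} ∣p∣≤q = subst (ℚ._≤ q ℚ.* q)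
  (trans (sym (ℚ.∣p*q∣≡∣p∣*∣q∣ p p)) (ℚ.0≤p⇒∣p∣≡p (0≤p*p p)))
  (*-mono-≤ (ℚ.0≤∣p∣ p) (ℚ.≤-trans (ℚ.0≤∣p∣ p) ∣p∣≤q) ∣p∣≤q ∣p∣≤q)

-- Each bisection iterate lies below the root it approximates, so its square is at most the
-- nonnegative part of the radicand.
∣∣ℂ≤ : ∀ n z {b} → 0ℚ ℚ.≤ b → normAt n z ℚ.≤ b ℚ.* b → seq ∣ z ∣ℂ n ℚ.≤ b
∣∣ℂ≤ n z {b} 0≤b z≤ = p*p≤q*q⇒p≤q 0≤b (ℚ.≤-trans
  (Brackets.lower (bisect√-brackets (ℚ.p≤p⊔q 0ℚ (normAt n z)) n))
  (ℚ.⊔-lub (0≤p*p b) z≤))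

-- To be read with `y` + i`y′` the tensor row, `w` + i`w′` the eigenvalue side, `m` the squared
-- modulus of the eigenvalue and `q` that of the power of the coordinate. If `h * h ≤ q`, the error
-- has modulus at most `t` times the root of `q`, so the triangle inequality bounds `m * q` by
-- `(d + t) * (d + t) * q`; cancelling `q` contradicts `large`.
perturbed-bound : ∀ m q y y′ w w′ {d t h} → 0ℚ ℚ.≤ d → 0ℚ ℚ.< t → 0ℚ ℚ.< h →
  norm y y′ ℚ.≤ d ℚ.* d ℚ.* q → norm w w′ ≡ m ℚ.* q →
  ℚ.∣ y ℚ.- w ∣ ℚ.≤ ½ ℚ.* (t ℚ.* h) → ℚ.∣ y′ ℚ.- w′ ∣ ℚ.≤ ½ ℚ.* (t ℚ.* h) →
  (d ℚ.+ t) ℚ.* (d ℚ.+ t) ℚ.< m → q ℚ.< h ℚ.* h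
perturbed-bound m q y y′ w w′ {d} {t} {h} 0≤d 0<t 0<h y≤ w≡ e≤ e′≤ large with h ℚ.* h ℚ.≤? q
... | no  h²≰q = ℚ.≰⇒> h²≰q
... | yes h²≤q = contradiction large (≤⇒≯ (ℚ.*-cancelʳ-≤-pos q {{ℚ.positive 0<q}} (begin
  m ℚ.* q                                        ≡⟨ w≡ ⟨
  norm w w′                                      ≡⟨ cong₂ norm (split y w) (split y′ w′) ⟩
  norm (y ℚ.+ (w ℚ.- y)) (y′ ℚ.+ (w′ ℚ.- y′))    ≤⟨ norm-+ {y} {y′} {w ℚ.- y} {w′ ℚ.- y′} 0≤d (ℚ.<⇒≤ 0<t) (ℚ.<⇒≤ 0<q) y≤ error≤ ⟩
  (d ℚ.+ t) ℚ.* (d ℚ.+ t) ℚ.* q                  ∎)))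
  where
  open ℚ.≤-Reasoning
  0<q = ℚ.<-≤-trans (0<* 0<h 0<h) h²≤q
  -- Both parts together give a squared error of at most twice `η * η`, within `t * t * (h * h)`,
  -- which is four times `η * η`.
  η = ½ ℚ.* (t ℚ.* h)
  split : ∀ u v → v ≡ u ℚ.+ (v ℚ.- u)
  split = solve 2 (λ u v → v := u :+ (v :- u)) refl
  flip : ∀ u v → ℚ.∣ u ℚ.- v ∣ ℚ.≤ η → (v ℚ.- u) ℚ.* (v ℚ.- u) ℚ.≤ η ℚ.* η
  flip u v ≤η = ∣p∣≤⇒p*p≤ {v ℚ.- u} (subst (ℚ._≤ η) (∣p-q∣≡∣q-p∣ u v) ≤η)
  error≤ : norm (w ℚ.- y) (w′ ℚ.- y′) ℚ.≤ t ℚ.* t ℚ.* q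
  error≤ = begin
    norm (w ℚ.- y) (w′ ℚ.- y′)
      ≤⟨ ℚ.+-mono-≤ (flip y w e≤) (flip y′ w′ e′≤) ⟩
    η ℚ.* η ℚ.+ η ℚ.* η
      ≤⟨ p≤p+q _ (0≤+ (0≤p*p η) (0≤p*p η)) ⟩
    η ℚ.* η ℚ.+ η ℚ.* η ℚ.+ (η ℚ.* η ℚ.+ η ℚ.* η)
      ≡⟨ solve 2 (λ t h → let e = con ½ :* (t :* h) in e :* e :+ e :* e :+ (e :* e :+ e :* e) := t :* t :* (h :* h)) refl t h ⟩
    t ℚ.* t ℚ.* (h ℚ.* h)
      ≤⟨ ℚ.*-monoˡ-≤-nonNeg (t ℚ.* t) {{ℚ.nonNegative (0≤p*p t)}} h²≤q ⟩
    t ℚ.* t ℚ.* q ∎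

-- The eigenvalue equation at a coordinate of largest modulus, and the resulting bound

module _ {N k} (a : Hypermatrix ℚ (suc k) N) {d : ℚ} (0≤d : 0ℚ ℚ.≤ d)
  (0≤a : ∀ α → 0ℚ ℚ.≤ a α) (rows : ∀ i → rowSum a i ℚ.≤ d) where

  -- Every monomial of degree `k` has squared modulus at most `q ^ k`, and the entries, being
  -- nonnegative, are their own moduli; the triangle inequality then brings in the row sum.
  normAt-apply : ∀ n (x : Vector ℂ N) {q} → 0ℚ ℚ.≤ q → (∀ j → normAt n (x j) ℚ.≤ q) → ∀ i →
    normAt n (((λ α → ℚ→ℂ (a α)) ⟨ x ⟩) i) ℚ.≤ d ℚ.* d ℚ.* q ^ℚ k
  normAt-apply n x {q} 0≤q x≤ i = ℚ.≤-trans
    (normAt-∑tuples n (0≤^ k 0≤q) k (λ α → ℚ→ℂ (a (i ∷ α)) *ℂ monomial x α) (λ α → a (i ∷ α)) (λ α → 0≤a (i ∷ α)) λ α →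
      subst (ℚ._≤ _) (sym (normAt-ℚ→ℂ-* n (a (i ∷ α)) (monomial x α)))
        (ℚ.*-monoˡ-≤-nonNeg (a (i ∷ α) ℚ.* a (i ∷ α)) {{ℚ.nonNegative (0≤p*p (a (i ∷ α)))}} (normAt-monomial n x α 0≤q x≤)))
    (ℚ.*-monoʳ-≤-nonNeg (q ^ℚ k) {{ℚ.nonNegative (0≤^ k 0≤q)}}
      (*-mono-≤ (0≤∑tuplesℚ k λ α → 0≤a (i ∷ α)) 0≤d (rows i) (rows i)))

  -- The exponent is left as suc k ∸ 1, and ℚ→ℂ ∘ a is left unnamed, to agree literally with
  -- IsEigenvalue: otherwise conversion checking unfolds the Cauchy proofs of the coordinates.
  maximal-small : ∀ n (x : Vector ℂ N) μ i {t h} → 0ℚ ℚ.< t → 0ℚ ℚ.< h →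
    (∀ j → normAt n (x j) ℚ.≤ normAt n (x i)) →
    ℚ.∣ seq (re (((λ α → ℚ→ℂ (a α)) ⟨ x ⟩) i)) n ℚ.- seq (re (μ *ℂ (x i ^ℂ (suc k ∸ 1)))) n ∣ ℚ.≤ ½ ℚ.* (t ℚ.* h) →
    ℚ.∣ seq (im (((λ α → ℚ→ℂ (a α)) ⟨ x ⟩) i)) n ℚ.- seq (im (μ *ℂ (x i ^ℂ (suc k ∸ 1)))) n ∣ ℚ.≤ ½ ℚ.* (t ℚ.* h) →
    (d ℚ.+ t) ℚ.* (d ℚ.+ t) ℚ.< normAt n μ →
    normAt n (x i) ^ℚ k ℚ.< h ℚ.* h
  maximal-small n x μ i 0<t 0<h max re≤ im≤ =
    perturbed-bound (normAt n μ) (normAt n (x i) ^ℚ k)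
      (seq (re (((λ α → ℚ→ℂ (a α)) ⟨ x ⟩) i)) n) (seq (im (((λ α → ℚ→ℂ (a α)) ⟨ x ⟩) i)) n)
      (seq (re (μ *ℂ (x i ^ℂ (suc k ∸ 1)))) n) (seq (im (μ *ℂ (x i ^ℂ (suc k ∸ 1)))) n) 0≤d 0<t 0<h
      (normAt-apply n x (0≤norm (seq (re (x i)) n) (seq (im (x i)) n)) max i)
      (trans (normAt-* n μ (x i ^ℂ (suc k ∸ 1))) (cong (normAt n μ ℚ.*_) (normAt-^ n (x i) k)))
      re≤ im≤

  -- At each late index the largest approximate coordinate is small by `maximal-small`, and it
  -- dominates coordinate `i`, whichever one it is.
  eigenvector-vanishes : ∀ (x : Vector ℂ N) μ {t} → 0ℚ ℚ.< t →
    (∀ i → ((λ α → ℚ→ℂ (a α)) ⟨ x ⟩) i ≃ℂ μ *ℂ (x i ^ℂ (suc k ∸ 1))) →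
    (∃ λ K → ∀ n → K ℕ.≤ n → (d ℚ.+ t) ℚ.* (d ℚ.+ t) ℚ.< normAt n μ) →
    ∀ i → x i ≃ℂ 0ℂ
  eigenvector-vanishes x μ {t} 0<t eq (K , large) i =
    (λ 0<δ → let (L , h) = small 0<δ in L , λ n L≤n → proj₁ (h n L≤n)) ,
    (λ 0<δ → let (L , h) = small 0<δ in L , λ n L≤n → proj₂ (h n L≤n))
    where
    small : ∀ {δ} → 0ℚ ℚ.< δ → ∃ λ L → ∀ n → L ℕ.≤ n →
      ℚ.∣ seq (re (x i)) n ℚ.- 0ℚ ∣ ℚ.≤ δ × ℚ.∣ seq (im (x i)) n ℚ.- 0ℚ ∣ ℚ.≤ δ
    small {δ} 0<δ = K ℕ.⊔ (R ℕ.⊔ I) , λ n le →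
      let R⊔I≤n = ℕ.m⊔n≤o⇒n≤o K (R ℕ.⊔ I) le
          (i* , max) = argmax i (λ j → normAt n (x j))
          -- Here `h` is `δ ^ k`, so that the `k`-th root taken next gives squared modulus below
          -- `δ * δ`. For `k` equal to 0 the inequality obtained is already absurd.
          xᵏ< = maximal-small n x μ i* 0<t (0<^ k 0<δ) max
            (re-close n (ℕ.m⊔n≤o⇒m≤o R I R⊔I≤n) i*) (im-close n (ℕ.m⊔n≤o⇒n≤o R I R⊔I≤n) i*)
            (large n (ℕ.m⊔n≤o⇒m≤o K (R ℕ.⊔ I) le))
          x< = ^-cancel-< k (0≤p*p δ) (subst (normAt n (x i*) ^ℚ k ℚ.<_) (sym (^-distrib-* δ δ k)) xᵏ<)
          xᵢ≤ = ℚ.≤-trans (max i) (ℚ.<⇒≤ x<)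
          u = seq (re (x i)) n
          v = seq (im (x i)) n
      in bound u (ℚ.≤-trans (p≤p+q (u ℚ.* u) (0≤p*p v)) xᵢ≤) ,
         bound v (ℚ.≤-trans (subst (v ℚ.* v ℚ.≤_) (ℚ.+-comm (v ℚ.* v) (u ℚ.* u)) (p≤p+q (v ℚ.* v) (0≤p*p u))) xᵢ≤)
      where
      0<η = half-pos (0<* 0<t (0<^ k 0<δ))
      re-ev = eventually-∀ λ i → proj₁ (eq i) 0<η
      im-ev = eventually-∀ λ i → proj₂ (eq i) 0<η
      R = proj₁ re-ev
      I = proj₁ im-ev
      re-close = proj₂ re-ev
      im-close = proj₂ im-ev
      bound : ∀ p → p ℚ.* p ℚ.≤ δ ℚ.* δ → ℚ.∣ p ℚ.- 0ℚ ∣ ℚ.≤ δ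
      bound p p²≤ = subst (λ r → ℚ.∣ r ∣ ℚ.≤ δ) (sym (ℚ.+-identityʳ p)) (∣p∣≤ (ℚ.<⇒≤ 0<δ) p²≤)

-- A constructive substitute for comparing a real with a rational: one approximation, from which all
-- later ones differ by at most `η`, is tested against `b + η`.
eventually-≤-or-> : ∀ y b {η} → 0ℚ ℚ.< η →
  (∃ λ K → ∀ n → K ℕ.≤ n → seq y n ℚ.≤ b ℚ.+ η ℚ.+ η) ⊎ (∃ λ K → ∀ n → K ℕ.≤ n → b ℚ.< seq y n)
eventually-≤-or-> y b {η} 0<η with cauchy y 0<η
... | K , close with seq y K ℚ.≤? b ℚ.+ η
...   | yes y≤ = inj₁ (K , λ n K≤n → ℚ.≤-trans
  (∣p-q∣≤⇒p≤q+ (seq y n) (seq y K) (close n K K≤n ℕ.≤-refl)) (ℚ.+-monoˡ-≤ η y≤))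
...   | no  y≰ = inj₂ (K , λ n K≤n → ℚ.≰⇒> λ yₙ≤b → y≰ (ℚ.≤-trans
  (∣p-q∣≤⇒p≤q+ (seq y K) (seq y n) (close K n ℕ.≤-refl K≤n)) (ℚ.+-monoˡ-≤ η yₙ≤b)))

-- Taking `t` as half of `ε` leaves room for the gap `η + η` of `eventually-≤-or->` with `η` equal
-- to `t * t`.
square-slack : ∀ {d ε} → 0ℚ ℚ.≤ d → 0ℚ ℚ.≤ ε → let t = ½ ℚ.* ε in
  (d ℚ.+ t) ℚ.* (d ℚ.+ t) ℚ.+ t ℚ.* t ℚ.+ t ℚ.* t ℚ.≤ (d ℚ.+ ε) ℚ.* (d ℚ.+ ε)
square-slack {d} {ε} 0≤d 0≤ε = begin
  (d ℚ.+ t) ℚ.* (d ℚ.+ t) ℚ.+ t ℚ.* t ℚ.+ t ℚ.* t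
    ≤⟨ p≤p+q _ (0≤+ (0≤+ 0≤dt 0≤dt) (0≤p*p t)) ⟩
  (d ℚ.+ t) ℚ.* (d ℚ.+ t) ℚ.+ t ℚ.* t ℚ.+ t ℚ.* t ℚ.+ (d ℚ.* t ℚ.+ d ℚ.* t ℚ.+ t ℚ.* t)
    ≡⟨ solve 2 (λ d e → let t = con ½ :* e in
         (d :+ t) :* (d :+ t) :+ t :* t :+ t :* t :+ (d :* t :+ d :* t :+ t :* t) := (d :+ e) :* (d :+ e)) refl d ε ⟩
  (d ℚ.+ ε) ℚ.* (d ℚ.+ ε) ∎
  where
  open ℚ.≤-Reasoning
  t = ½ ℚ.* ε
  0≤dt = 0≤* 0≤d (0≤* (ℚ.nonNegative⁻¹ ½) 0≤ε)

-- Either the squared modulus of `μ` eventually stays within the slack, which is the desired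
-- estimate for this `ε`, or it eventually exceeds `(d + t) * (d + t)`, and then the eigenvector
-- would be zero.
spectral-bound : ∀ {m N} .{{_ : ℕ.NonZero m}} (a : Hypermatrix ℚ m N) {d} → 0ℚ ℚ.≤ d →
  (∀ α → 0ℚ ℚ.≤ a α) → (∀ i → rowSum a i ℚ.≤ d) → ∀ μ →
  IsEigenvalue {m} (λ α → ℚ→ℂ (a α)) μ → ∣ μ ∣ℂ ≤ℝ fromℚ d
spectral-bound {suc k} a {d} 0≤d 0≤a rows μ (x , x≄0 , eq) {ε} 0<ε =
  Sum.[ (λ (K , μ≤) → K , λ n K≤n →
          ∣∣ℂ≤ n μ (0≤+ 0≤d (ℚ.<⇒≤ 0<ε)) (ℚ.≤-trans (μ≤ n K≤n) (square-slack 0≤d (ℚ.<⇒≤ 0<ε))))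
      , (λ large → contradiction (eigenvector-vanishes a 0≤d 0≤a rows x μ 0<t eq large) x≄0)
      ]′ (eventually-≤-or-> (re μ *ℝ re μ +ℝ im μ *ℝ im μ) ((d ℚ.+ t) ℚ.* (d ℚ.+ t)) (0<* 0<t 0<t))
  where
  t = ½ ℚ.* ε
  0<t = half-pos 0<ε

-- The uniformized hb-graph

multFactorials-++ : ∀ {m n} (M : NatMultiset m) (L : NatMultiset n) →
                    multFactorials (M ++ L) ≡ multFactorials M ℕ.* multFactorials L
multFactorials-++ {zero}  M L = sym (ℕ.*-identityˡ _)
multFactorials-++ {suc m} M L = trans
  (cong (M zero ! ℕ.*_) (trans
    (productℕ-cong λ v → cong _! ([,]-map (splitAt m v)))
    (multFactorials-++ (λ v → M (suc v)) L)))
  (sym (ℕ.*-assoc (M zero !) _ _))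

1≤multFactorials : ∀ {n} (M : NatMultiset n) → 1 ℕ.≤ multFactorials M
1≤multFactorials {zero}  M = ℕ.≤-refl
1≤multFactorials {suc n} M = ℕ.*-mono-≤ (ℕ.1≤n! (M zero)) (1≤multFactorials λ v → M (suc v))

!≤multFactorials : ∀ {n} (M : NatMultiset n) v → M v ! ℕ.≤ multFactorials M
!≤multFactorials M zero    = subst (ℕ._≤ multFactorials M) (ℕ.*-identityʳ _)
  (ℕ.*-monoʳ-≤ (M zero !) (1≤multFactorials λ v → M (suc v)))
!≤multFactorials M (suc v) = subst (ℕ._≤ multFactorials M) (ℕ.*-identityˡ _)
  (ℕ.*-mono-≤ (ℕ.1≤n! (M zero)) (!≤multFactorials (λ v → M (suc v)) v))

#ₘ≢0 : ∀ {n} (M : NatMultiset n) → ¬ IsEmpty M → #ₘ M ≢ 0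
#ₘ≢0 M nonempty #M≡0 = nonempty (all-zero M #M≡0)
  where
  all-zero : ∀ {n} (M : NatMultiset n) → #ₘ M ≡ 0 → IsEmpty M
  all-zero M #M≡0 zero    = ℕ.m+n≡0⇒m≡0 (M zero) #M≡0
  all-zero M #M≡0 (suc v) = all-zero (λ v → M (suc v)) (ℕ.m+n≡0⇒n≡0 (M zero) #M≡0) v

-- The multiset `added silo` with rank and m-cardinality as free variables, so that the cardinality
-- can be analysed by cases.
siloAdded : ∀ r → ℕ → NatMultiset (r ∸ 1)
siloAdded r c k = if ⌊ suc (toℕ k) ℕ.≟ c ⌋ then r ∸ c else 0

-- For `0 < c < r` one null vertex carries multiplicity `r ∸ c`, and its factorial is a factor of
-- the product. For `c ≥ r` the left side is `0 !`. No null vertex has number 0, whence `c ≢ 0`.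
!≤multFactorials-siloAdded : ∀ r c → c ≢ 0 → (r ∸ c) ! ℕ.≤ multFactorials (siloAdded r c)
!≤multFactorials-siloAdded r zero    c≢0 = contradiction refl c≢0
!≤multFactorials-siloAdded r (suc c) _ with suc c ℕ.<? r
... | no  c≮r = subst (λ d → d ! ℕ.≤ multFactorials (siloAdded r (suc c)))
  (sym (ℕ.m≤n⇒m∸n≡0 (ℕ.≮⇒≥ c≮r))) (1≤multFactorials (siloAdded r (suc c)))
... | yes c<r = subst (λ d → d ! ℕ.≤ multFactorials (siloAdded r (suc c)))
  added≡ (!≤multFactorials (siloAdded r (suc c)) k)
  where
  c<r-1 : c ℕ.< r ∸ 1
  c<r-1 = ℕ.∸-monoˡ-≤ 1 c<r
  -- Null vertices are numbered from 1, so the one for cardinality `suc c` has index `c`.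
  k = fromℕ< c<r-1
  added≡ : siloAdded r (suc c) k ≡ r ∸ suc c
  added≡ with suc (toℕ k) ℕ.≟ suc c
  ... | yes _  = refl
  ... | no k≢c = contradiction (cong suc (Fin.toℕ-fromℕ< c<r-1)) k≢c

multFactorials-uniformized : ∀ κ H l {f} → f ℕ.≤ multFactorials (added κ H l) →
                             multFactorials (edge H l) ℕ.* f ℕ.≤ multFactorials (uniformized κ H l)
multFactorials-uniformized κ H l {f} f≤ = subst (multFactorials (edge H l) ℕ.* f ℕ.≤_)
  (sym (multFactorials-++ (edge H l) (added κ H l)))
  (ℕ.*-monoʳ-≤ (multFactorials (edge H l)) f≤)

-- In each kind the numerator of the weight is at most the factorial product of the uniformized
-- edge. For the layered tensor the added indices enter with the factor 1.
rowSum-contributions : ∀ H → NoEmptyEdge H → .{{_ : ℕ.NonZero (rank H)}} → ∀ κ i →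
  rowSum (λ α → sumℚ λ l → contribution κ H l α) i ℚ.≤ ι (sumℕ λ l → uniformized κ H l i)
rowSum-contributions H noEmpty straightforward = rowSum-mult (uniformized straightforward H) _ λ l →
  multFactorials-uniformized straightforward H l (!≤multFactorials (added straightforward H l) zero)
rowSum-contributions H noEmpty silo = rowSum-mult (uniformized silo H) _ λ l →
  multFactorials-uniformized silo H l
    (!≤multFactorials-siloAdded (rank H) (#ₘ (edge H l)) (#ₘ≢0 (edge H l) (noEmpty l)))
rowSum-contributions H noEmpty layered = rowSum-mult (uniformized layered H) (λ l → multFactorials (edge H l)) λ l →
  subst (ℕ._≤ multFactorials (uniformized layered H l)) (ℕ.*-identityʳ _)
    (multFactorials-uniformized layered H l (1≤multFactorials (added layered H l)))

term≤maximum : ∀ {n} (f : Vector ℕ n) i → f i ℕ.≤ maximum f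
term≤maximum f zero    = ℕ.m≤m⊔n (f zero) _
term≤maximum f (suc i) = ℕ.≤-trans (term≤maximum (λ j → f (suc j)) i) (ℕ.m≤n⊔m (f zero) _)

degree-bound : ∀ κ H i → sumℕ (λ l → uniformized κ H l i) ℕ.≤ Δ H ℕ.⊔ Δ⋆ κ H
degree-bound κ H i = subst (λ i → sumℕ (λ l → uniformized κ H l i) ℕ.≤ Δ H ℕ.⊔ Δ⋆ κ H)
  (Fin.join-splitAt (order H) (nulls κ H) i) (bound (splitAt (order H) i))
  where
  bound : ∀ s → sumℕ (λ l → uniformized κ H l (join (order H) (nulls κ H) s)) ℕ.≤ Δ H ℕ.⊔ Δ⋆ κ H
  bound (inj₁ v) = begin
    sumℕ (λ l → uniformized κ H l (v ↑ˡ nulls κ H)) ≡⟨ sumℕ-cong (λ l → lookup-++ˡ (edge H l) (added κ H l) v) ⟩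
    degₘ H v                                        ≤⟨ term≤maximum (degₘ H) v ⟩
    Δ H                                             ≤⟨ ℕ.m≤m⊔n (Δ H) (Δ⋆ κ H) ⟩
    Δ H ℕ.⊔ Δ⋆ κ H                                  ∎
    where open ℕ.≤-Reasoning
  -- For a null vertex the column sum is `nullDegₘ` by definition.
  bound (inj₂ k) = ℕ.≤-trans (term≤maximum (nullDegₘ κ H) k) (ℕ.m≤n⊔m (Δ H) (Δ⋆ κ H))

0≤value : ∀ κ H l → 0ℚ ℚ.≤ value κ H l
0≤value straightforward H l = 0≤/ (multFactorials (edge H l) ℕ.* (rank H ∸ #ₘ (edge H l)) !) ((rank H ∸ 1) !)
  {{(rank H ∸ 1) ℕ.!≢0}}
0≤value silo            H l = 0≤/ (multFactorials (edge H l) ℕ.* (rank H ∸ #ₘ (edge H l)) !) ((rank H ∸ 1) !)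
  {{(rank H ∸ 1) ℕ.!≢0}}
0≤value layered         H l = 0≤/ (multFactorials (edge H l)) ((rank H ∸ 1) !) {{(rank H ∸ 1) ℕ.!≢0}}

0≤contribution : ∀ κ H l α → 0ℚ ℚ.≤ contribution κ H l α
0≤contribution κ H l α with arranges? α (uniformized κ H l)
... | yes _ = 0≤value κ H l
... | no  _ = ℚ.≤-refl

claim5p3 : (H : HbGraph) → NoRepeatedEdge H → (noEmpty : NoEmptyEdge H) →
    .{{_ : NonZero (size H)}} → (κ : Kind) → (μ : ℂ) →
    IsEigenvalue {{rank≢0 H noEmpty}} (adjacencyTensor κ H) μ →
    ∣ μ ∣ℂ ≤ℝ fromℕ ((Δ H ⊔ Δ⋆ κ H) + rank H)
claim5p3 H _ noEmpty κ μ = spectral-bound {{rank≢0 H noEmpty}} (λ α → sumℚ λ l → contribution κ H l α)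
  (0≤/ ((Δ H ⊔ Δ⋆ κ H) + rank H) 1)
  (λ α → 0≤sumℚ λ l → 0≤contribution κ H l α)
  -- Row `i` sums to at most the degree of `i`, which is compared with the larger of `Δ H` and
  -- `Δ⋆ κ H` and then with the full bound.
  (λ i → ℚ.≤-trans (rowSum-contributions H noEmpty {{rank≢0 H noEmpty}} κ i)
    (ι-mono (ℕ.≤-trans (degree-bound κ H i) (ℕ.m≤m+n (Δ H ⊔ Δ⋆ κ H) (rank H)))))
  μ
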